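{- Let $H$ be a graph. The class of $H$-free near-bipartite graphs is ifvs-bounded if and only if $H$ is isomorphic to $P_1+P_2$, a star or an edgeless graph.
   Context: Graphs are finite, simple and undirected. A graph is $H$-free if it has no induced subgraph isomorphic to $H$. $G+H$ is the disjoint union of $G$ and $H$; $P_n$ is the path on $n$ vertices. A star is a graph $K_{1,r}$ with $r\geq 0$. A feedback vertex set of $G$ is a set $S\subseteq V(G)$ such that $G-S$ is a forest; it is independent if $S$ is an independent set. A graph is near-bipartite if it has an independent feedback vertex set, i.e. its vertex set can be partitioned into an independent set and a set inducing a forest. For a near-bipartite graph $G$, $\mathrm{fvs}(G)$ is the minimum size of a feedback vertex set and $\mathrm{ifvs}(G)$ is the minimum size of an independent feedback vertex set. A class $\mathcal X$ of near-bipartite graphs is ifvs-bounded if there is a function $f:\mathbb{Z}_{\geq 0}\to\mathbb{Z}_{\geq 0}$ such that $\mathrm{ifvs}(G)\leq f(\mathrm{fvs}(G))$ for every $G\in\mathcal X$. -}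

module Defs where

open import Data.Empty using (⊥)
open import Data.Fin using (Fin; zero; suc; toℕ; inject₁; fromℕ)
open import Data.Fin.Subset using (Subset; _∈_; ∁; ∣_∣)
open import Data.Nat using (ℕ; suc; _+_; _≤_; _≟_)
open import Data.Nat.Properties using (1+n≢n)
open import Data.Product using (Σ; ∃-syntax; _×_; proj₁)
open import Data.Sum using (_⊎_; inj₁; inj₂; swap)
open import Data.Sum.Relation.Binary.Pointwise
  using (Pointwise; ⊎-symmetric; ⊎-irreflexive; ⊎-decidable; ≡⇒Pointwise-≡)
open import Data.Unit using (⊤; tt)
open import Function.Base using (_on_)
open import Function.Bundles using (_↔_; _⇔_; Inverse)
open import Function.Definitions using (Injective)
open import Level using (0ℓ)
open import Relation.Binary.Core using (Rel)
open import Relation.Binary.Definitions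
  using (Symmetric; Irreflexive; Decidable)
open import Relation.Binary.PropositionalEquality using (_≡_; refl; sym; cong)
open import Relation.Nullary using (¬_; yes; no)
open import Relation.Nullary.Decidable using (_⊎-dec_)

-- Finiteness is not part of this record: the finite graphs are, up to
-- isomorphism, those of type Graph (Fin n).
record Graph (V : Set) : Set₁ where
  field
    Adj    : Rel V 0ℓ
    symm   : Symmetric Adj
    irrefl : Irreflexive _≡_ Adj
    adj?   : Decidable Adj

open Graph public

infix 4 _≅_

_≅_ : ∀ {V W} → Graph V → Graph W → Set
_≅_ {V} {W} G H =
  Σ (V ↔ W) λ φ → ∀ u v → Adj G u v ⇔ Adj H (Inverse.to φ u) (Inverse.to φ v)

infix 8 _[_]

_[_] : ∀ {n} → Graph (Fin n) → (S : Subset n) → Graph (∃[ v ] v ∈ S)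
G [ S ] = record
  { Adj    = Adj G on proj₁
  ; symm   = symm G
  ; irrefl = λ u≡v → irrefl G (cong proj₁ u≡v)
  ; adj?   = λ u v → adj? G (proj₁ u) (proj₁ v)
  }

infixr 6 _⊕_

_⊕_ : ∀ {V W} → Graph V → Graph W → Graph (V ⊎ W)
G ⊕ H = record
  { Adj    = Pointwise (Adj G) (Adj H)
  ; symm   = ⊎-symmetric (symm G) (symm H)
  ; irrefl = λ u≡v → ⊎-irreflexive (irrefl G) (irrefl H) (≡⇒Pointwise-≡ u≡v)
  ; adj?   = ⊎-decidable (adj? G) (adj? H)
  }

P : ∀ n → Graph (Fin n)
P n = record
  { Adj    = λ i j → toℕ j ≡ suc (toℕ i) ⊎ toℕ i ≡ suc (toℕ j)
  ; symm   = swap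
  ; irrefl = λ { refl (inj₁ e) → 1+n≢n (sym e) ; refl (inj₂ e) → 1+n≢n (sym e) }
  ; adj?   = λ i j → (toℕ j ≟ suc (toℕ i)) ⊎-dec (toℕ i ≟ suc (toℕ j))
  }

K : ∀ m n → Graph (Fin m ⊎ Fin n)
K m n = record
  { Adj    = A
  ; symm   = λ {u} {v} → A-sym u v
  ; irrefl = λ { {u} refl → A-irrefl u }
  ; adj?   = A?
  }
  where
  A : Rel (Fin m ⊎ Fin n) 0ℓ
  A (inj₁ _) (inj₁ _) = ⊥
  A (inj₁ _) (inj₂ _) = ⊤
  A (inj₂ _) (inj₁ _) = ⊤
  A (inj₂ _) (inj₂ _) = ⊥

  A-sym : ∀ u v → A u v → A v u
  A-sym (inj₁ _) (inj₂ _) _ = tt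
  A-sym (inj₂ _) (inj₁ _) _ = tt

  A-irrefl : ∀ u → ¬ A u u
  A-irrefl (inj₁ _) ()
  A-irrefl (inj₂ _) ()

  A? : Decidable A
  A? (inj₁ _) (inj₁ _) = no λ ()
  A? (inj₁ _) (inj₂ _) = yes tt
  A? (inj₂ _) (inj₁ _) = yes tt
  A? (inj₂ _) (inj₂ _) = no λ ()

edgeless : ∀ n → Graph (Fin n)
edgeless n = record
  { Adj    = λ _ _ → ⊥
  ; symm   = λ ()
  ; irrefl = λ _ ()
  ; adj?   = λ _ _ → no λ ()
  }

IsStar : ∀ {V} → Graph V → Set
IsStar G = ∃[ r ] G ≅ K 1 r

IsEdgeless : ∀ {V} → Graph V → Set
IsEdgeless G = ∃[ n ] G ≅ edgeless n

-- A cycle on 3 + k distinct vertices, not necessarily induced.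
record Cycle {V : Set} (G : Graph V) : Set where
  field
    k         : ℕ
    vertex    : Fin (3 + k) → V
    injective : Injective _≡_ _≡_ vertex
    step      : ∀ (i : Fin (2 + k)) → Adj G (vertex (inject₁ i)) (vertex (suc i))
    close     : Adj G (vertex (fromℕ (2 + k))) (vertex zero)

IsForest : ∀ {V} → Graph V → Set
IsForest G = ¬ Cycle G

module _ {n : ℕ} (G : Graph (Fin n)) where

  IsIndependent : Subset n → Set
  IsIndependent S = ∀ u v → u ∈ S → v ∈ S → ¬ Adj G u v

  IsFVS : Subset n → Set
  IsFVS S = IsForest (G [ ∁ S ])

  IsIFVS : Subset n → Set
  IsIFVS S = IsFVS S × IsIndependent S

  NearBipartite : Set
  NearBipartite = ∃[ S ] IsIFVS S

  Free : ∀ {m} → Graph (Fin m) → Set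
  Free H = ¬ (∃[ S ] H ≅ G [ S ])

IsMinSize : ∀ {n} → (Subset n → Set) → ℕ → Set
IsMinSize Q k = (∃[ S ] Q S × ∣ S ∣ ≡ k) × (∀ S → Q S → k ≤ ∣ S ∣)

-- The values fvs(G) and ifvs(G), given by their graphs as partial functions:
-- k is unique by antisymmetry of _≤_.
Fvs≡ : ∀ {n} → Graph (Fin n) → ℕ → Set
Fvs≡ G k = IsMinSize (IsFVS G) k

Ifvs≡ : ∀ {n} → Graph (Fin n) → ℕ → Set
Ifvs≡ G k = IsMinSize (IsIFVS G) k

GraphClass : Set₁
GraphClass = ∀ n → Graph (Fin n) → Set

FreeNearBipartite : ∀ {m} → Graph (Fin m) → GraphClass
FreeNearBipartite H n G = Free G H × NearBipartite G

-- X is meant to consist of near-bipartite graphs, for which both values exist.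
IfvsBounded : GraphClass → Set₁
IfvsBounded X =
  Σ (ℕ → ℕ) λ f → ∀ n (G : Graph (Fin n)) → X n G →
    ∀ a b → Fvs≡ G a → Ifvs≡ G b → b ≤ f a

-- If H is not in the list, it contains a triangle, or an induced C₄, P₄, 2P₁ + P₂, 2P₂ or
-- P₁ + P₃.  Two adjacent hubs, each on r otherwise disjoint 4-cycles (or triangles), have fvs
-- at most 2 but ifvs at least r, which excludes triangles (or C₄).  The join of r isolated
-- vertices with 2P₂ or P₄ has fvs at most 4 but ifvs at least r - 1.  The former excludes P₄, the
-- latter the three remaining graphs.
--
-- Conversely, let T be a minimum feedback vertex set and I a minimum independent one.  If G is
-- (P₁ + P₂)-free, it is complete multipartite and |I| ≤ |T| + 1 by inspection of the parts.  If G
-- is K₁,ᵣ-free, then N[T] is bounded in terms of |T| and r, as G - T is triangle-free.  Each v in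
-- I outside N[T] lies on a cycle meeting I only in v, so v lies on a walk of the forest G - T
-- between two vertices of N[T] which meets I only in v.  Two vertices v with the same
-- pair of ends would produce a cycle in G - T, so |I| ≤ |N[T]| + |N[T]|².
module Submission where

open import Defs
open import Data.Empty using (⊥; ⊥-elim)
open import Data.Fin
  using (Fin; zero; suc; toℕ; inject₁; fromℕ; _≟_; inject≤; combine; opposite; punchIn; punchOut)
open import Data.Fin.Properties
  using (any?; injective⇒≤; suc-injective; toℕ-inject₁; toℕ-fromℕ; toℕ<n; all?; inject≤-injective;
        combine-injective; sequence; +↔⊎; *↔×; toℕ-injective; punchInᵢ≢i; punchIn-injective;
        punchIn-punchOut)
open import Data.Fin.Relation.Unary.Top using (view; ‵fromℕ; ‵inject₁)
open import Data.Fin.Subset using (Subset; inside; outside; _∈_; _∉_; _⊆_; ∁; ∣_∣; _─_; _-_; ⁅_⁆)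
open import Data.Fin.Subset.Properties
  using (x∈∁p⇒x∉p; x∉p⇒x∈∁p; _∈?_; p─q⊆p; p⊆q⇒∣p∣≤∣q∣; x∈p∧x≢y⇒x∈p-y; x∈p⇒∣p-x∣<∣p∣; x∈⁅x⁆; ∣⁅x⁆∣≡1;
        x∈p∧x∉q⇒x∈p─q)
open import Data.Nat using (ℕ; zero; suc; _+_; _*_; _≤_; _<_; z≤n; s≤s; s≤s⁻¹; _⊔_)
open import Data.Nat.Induction using (<-wellFounded)
open import Data.Nat.Properties
  using (≤-refl; ≤-trans; ≤-reflexive; <-irrefl; m≤n⇒m≤1+n; n<1+n; ≰⇒>; _≤?_; +-suc; module ≤-Reasoning;
        ≰⇒≥; +-cancelˡ-≤; +-mono-≤; *-mono-≤; ≤⇒≯; <⇒≤; +-comm; +-monoʳ-≤; m≤m+n; m≤m⊔n; m≤n⊔m;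
        m≤n⇒m<n∨m≡n)
open import Data.Product using (Σ; ∃-syntax; _×_; _,_; proj₁; proj₂)
open import Data.Product.Function.NonDependent.Propositional using (_×-↔_)
open import Data.Sum using (_⊎_; inj₁; inj₂)
open import Data.Sum.Function.Propositional using (_⊎-↔_)
open import Data.Sum.Properties using (inj₂-injective)
open import Data.Sum.Relation.Binary.Pointwise using (inj₁; inj₂)
open import Data.Unit using (⊤; tt)
open import Data.Vec using (_∷_; []; here; there; tabulate)
open import Data.Vec.Properties using (lookup∘tabulate; lookup⇒[]=; []=⇒lookup)
open import Data.Vec.Properties.WithK using ([]=-irrelevant)
open import Effect.Monad using (RawMonad)
open import Function.Base using (_∘_; id; case_of_; _on_)
open import Function.Bundles using (_⇔_; Equivalence; _↔_; Inverse; mk⇔; mk↔ₛ′)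
open import Function.Construct.Composition using (_⇔-∘_; _↔-∘_)
open import Function.Construct.Identity using (↔-id)
open import Function.Definitions using (Injective)
open import Induction.WellFounded using (Acc; acc)
open import Relation.Binary.PropositionalEquality using (_≡_; _≢_; refl; sym; trans; cong; subst; subst₂)
open import Relation.Nullary using (¬_; Dec; yes; no; does; contradiction)
open import Relation.Nullary.Decidable
  using (dec-true; _×-dec_; _⊎-dec_; ¬?; decidable-stable; _→-dec_; from-yes)
open import Relation.Nullary.Negation using (¬¬-Monad)
open import Relation.Unary using (Decidable)

private variable
  m n s : ℕ
  V W : Set

-- Finite subsets

⟦_⟧ : {P : Fin n → Set} → Decidable P → Subset n
⟦ P? ⟧ = tabulate (does ∘ P?)

module _ {P : Fin n → Set} (P? : Decidable P) where

  ∈⟦⟧⁺ : ∀ {x} → P x → x ∈ ⟦ P? ⟧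
  ∈⟦⟧⁺ {x} px = lookup⇒[]= x ⟦ P? ⟧ (trans (lookup∘tabulate (does ∘ P?) x) (dec-true (P? x) px))

  ∈⟦⟧⁻ : ∀ {x} → x ∈ ⟦ P? ⟧ → P x
  ∈⟦⟧⁻ {x} x∈ with P? x | trans (sym (lookup∘tabulate (does ∘ P?) x)) ([]=⇒lookup x∈)
  ... | yes px | _ = px
  ... | no _   | ()

enum : (U : Subset n) → Fin ∣ U ∣ → Fin n
enum (inside  ∷ U) zero    = zero
enum (inside  ∷ U) (suc i) = suc (enum U i)
enum (outside ∷ U) i       = suc (enum U i)

enum-∈ : ∀ (U : Subset n) i → enum U i ∈ U
enum-∈ (inside  ∷ U) zero    = here
enum-∈ (inside  ∷ U) (suc i) = there (enum-∈ U i)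
enum-∈ (outside ∷ U) i       = there (enum-∈ U i)

enum-injective : ∀ (U : Subset n) → Injective _≡_ _≡_ (enum U)
enum-injective (inside  ∷ U) {zero}  {zero}  _  = refl
enum-injective (inside  ∷ U) {suc i} {suc j} eq = cong suc (enum-injective U (suc-injective eq))
enum-injective (outside ∷ U) eq = enum-injective U (suc-injective eq)

index : ∀ (U : Subset n) {v} → v ∈ U → Fin ∣ U ∣
index (inside  ∷ U) here      = zero
index (inside  ∷ U) (there p) = suc (index U p)
index (outside ∷ U) (there p) = index U p

index-injective : ∀ (U : Subset n) {u v} (p : u ∈ U) (q : v ∈ U) → index U p ≡ index U q → u ≡ v
index-injective (inside  ∷ U) here      here      _  = refl
index-injective (inside  ∷ U) (there p) (there q) eq = cong suc (index-injective U p q (suc-injective eq))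
index-injective (outside ∷ U) (there p) (there q) eq = cong suc (index-injective U p q eq)

∣∣-≤ : ∀ (U : Subset n) (f : ∀ {v} → v ∈ U → Fin s) →
  (∀ {u v} (p : u ∈ U) (q : v ∈ U) → f p ≡ f q → u ≡ v) → ∣ U ∣ ≤ s
∣∣-≤ U f f-inj = injective⇒≤ {f = λ i → f (enum-∈ U i)} λ eq → enum-injective U (f-inj _ _ eq)

∣∣-≥ : ∀ (U : Subset n) (g : Fin s → Fin n) → Injective _≡_ _≡_ g → (∀ i → g i ∈ U) → s ≤ ∣ U ∣
∣∣-≥ U g g-inj g∈ = injective⇒≤ {f = λ i → index U (g∈ i)} λ eq → g-inj (index-injective U _ _ eq)

∣p∣≤∣q∣+∣p─q∣ : ∀ (p q : Subset n) → ∣ p ∣ ≤ ∣ q ∣ + ∣ p ─ q ∣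
∣p∣≤∣q∣+∣p─q∣ []            []            = z≤n
∣p∣≤∣q∣+∣p─q∣ (inside  ∷ p) (inside  ∷ q) = s≤s (∣p∣≤∣q∣+∣p─q∣ p q)
∣p∣≤∣q∣+∣p─q∣ (outside ∷ p) (inside  ∷ q) = m≤n⇒m≤1+n (∣p∣≤∣q∣+∣p─q∣ p q)
∣p∣≤∣q∣+∣p─q∣ (inside  ∷ p) (outside ∷ q) =
  ≤-trans (s≤s (∣p∣≤∣q∣+∣p─q∣ p q)) (≤-reflexive (sym (+-suc ∣ q ∣ ∣ p ─ q ∣)))
∣p∣≤∣q∣+∣p─q∣ (outside ∷ p) (outside ∷ q) = ∣p∣≤∣q∣+∣p─q∣ p q

x∈p─q⇒x∉q : ∀ (p q : Subset n) {x} → x ∈ p ─ q → x ∉ q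
x∈p─q⇒x∉q (_ ∷ p) (_ ∷ q) (there x∈) (there x∈q) = x∈p─q⇒x∉q p q x∈ x∈q

-- Walks

-- The condition on the visited vertices, both ends included, is part of the type, so that avoiding
-- a set survives concatenation, reversal and shortening.
data Walk (G : Graph V) (W : V → Set) : V → V → Set where
  stop : ∀ {x} → W x → Walk G W x x
  step : ∀ {x y z} → W x → Adj G x y → Walk G W y z → Walk G W x z

module _ {V V′ : Set} {G : Graph V} {G′ : Graph V′} {W : V → Set} {W′ : V′ → Set}
  (f : V → V′) (f-W : ∀ {x} → W x → W′ (f x)) (f-Adj : ∀ {x y} → Adj G x y → Adj G′ (f x) (f y)) where

  mapᵂ : ∀ {x y} → Walk G W x y → Walk G′ W′ (f x) (f y)
  mapᵂ (stop w)     = stop (f-W w)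
  mapᵂ (step w a p) = step (f-W w) (f-Adj a) (mapᵂ p)

module _ {G : Graph V} where

  weaken : ∀ {P Q : V → Set} → (∀ {x} → P x → Q x) → ∀ {x y} → Walk G P x y → Walk G Q x y
  weaken P⊆Q = mapᵂ id P⊆Q id

  infixr 5 _▷⟨_⟩_

  _▷⟨_⟩_ : ∀ {P : V → Set} {x y y′ z} → Walk G P x y → Adj G y y′ → Walk G P y′ z → Walk G P x z
  stop w     ▷⟨ e ⟩ q = step w e q
  step w a p ▷⟨ e ⟩ q = step w a (p ▷⟨ e ⟩ q)

  _++_ : ∀ {P : V → Set} {x y z} → Walk G P x y → Walk G P y z → Walk G P x z
  stop w     ++ q = q
  step w a p ++ q = step w a (p ++ q)

  reverse : ∀ {P : V → Set} {x y} → Walk G P x y → Walk G P y x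
  reverse (stop w)     = stop w
  reverse (step w a p) = reverse p ▷⟨ symm G a ⟩ stop w

  module _ {P : V → Set} where

    length : ∀ {x y} → Walk G P x y → ℕ
    length (stop _)     = zero
    length (step _ _ p) = suc (length p)

    at : ∀ {x y} (p : Walk G P x y) → Fin (suc (length p)) → V
    at {x} _            zero    = x
    at     (step _ _ p) (suc i) = at p i

    at-P : ∀ {x y} (p : Walk G P x y) i → P (at p i)
    at-P (stop w)     zero    = w
    at-P (step w _ _) zero    = w
    at-P (step _ _ p) (suc i) = at-P p i

    at-last : ∀ {x y} (p : Walk G P x y) → at p (fromℕ (length p)) ≡ y
    at-last (stop _)     = refl
    at-last (step _ _ p) = at-last p

    at-step : ∀ {x y} (p : Walk G P x y) i → Adj G (at p (inject₁ i)) (at p (suc i))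
    at-step (step _ a _)              zero    = a
    at-step (step _ _ p@(step _ _ _)) (suc i) = at-step p i

    Simple : ∀ {x y} → Walk G P x y → Set
    Simple (stop _)         = ⊤
    Simple (step {x} _ _ p) = (∀ i → at p i ≢ x) × Simple p

    at-injective : ∀ {x y} (p : Walk G P x y) → Simple p → Injective _≡_ _≡_ (at p)
    at-injective _            _       {zero}  {zero}  _  = refl
    at-injective (step _ _ p) (x∉ , _) {zero}  {suc j} eq = contradiction (sym eq) (x∉ j)
    at-injective (step _ _ p) (x∉ , _) {suc i} {zero}  eq = contradiction eq (x∉ i)
    at-injective (step _ _ p) (_ , s) {suc i} {suc j} eq = cong suc (at-injective p s eq)

    suffix : ∀ {x y} (p : Walk G P x y) → Simple p → ∀ i → Σ (Walk G P (at p i) y) Simple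
    suffix p            s       zero    = p , s
    suffix (step _ _ p) (_ , s) (suc i) = suffix p s i

-- Loop erasure from the far end: if the new first vertex already occurs on the shortened remainder,
-- the path starts at that occurrence instead.
toSimple : ∀ {G : Graph (Fin n)} {P x y} → Walk G P x y → Σ (Walk G P x y) Simple
toSimple (stop w) = stop w , tt
toSimple {P = P} {y = y} (step {x} w a p) with toSimple p
... | q , s with any? (λ i → at q i ≟ x)
... | yes (i , refl) = suffix q s i
... | no x∉q = step w a q , (λ i eq → x∉q (i , eq)) , s

-- The walk is shortened to a path, to which `v` is added. As `p` and `q` differ, the path has an
-- edge, so the cycle has at least three vertices. All cycles of `G - T` used in contradictions
-- arise from this.
closeWalk : ∀ (G : Graph (Fin n)) (T : Subset n) {v p q} → v ∉ T → p ≢ q → Adj G v p → Adj G v q →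
  Walk G (λ w → w ∉ T × w ≢ v) p q → Cycle (G [ ∁ T ])
closeWalk G T {v} {p} {q} v∉T p≢q vp vq walk with toSimple walk
... | stop _ , _ = contradiction refl p≢q
... | path@(step _ _ tail) , simple = record
  { k         = length tail
  ; vertex    = vertex
  ; injective = λ eq → inj (cong proj₁ eq)
  ; step      = λ { zero → vp ; (suc i) → at-step path i }
  ; close     = subst (λ w → Adj G w v) (sym (at-last path)) (symm G vq)
  }
  where
  vertex : Fin (3 + length tail) → ∃[ w ] w ∈ ∁ T
  vertex zero    = v , x∉p⇒x∈∁p v∉T
  vertex (suc i) = at path i , x∉p⇒x∈∁p (proj₁ (at-P path i))

  inj : ∀ {i j} → proj₁ (vertex i) ≡ proj₁ (vertex j) → i ≡ j
  inj {zero}  {zero}  _  = refl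
  inj {zero}  {suc j} eq = contradiction (sym eq) (proj₂ (at-P path j))
  inj {suc i} {zero}  eq = contradiction eq (proj₂ (at-P path i))
  inj {suc i} {suc j} eq = cong suc (at-injective path simple eq)

-- Cycles with one vertex removed

module _ {G : Graph V} where

  -- The bound on the indices later certifies that the walk misses the vertex removed from the
  -- cycle.
  prefixWalk : ∀ N (c : Fin (suc N) → V) → (∀ i → Adj G (c (inject₁ i)) (c (suc i))) → ∀ j →
    Walk G (λ w → ∃[ m ] toℕ m ≤ toℕ j × w ≡ c m) (c zero) (c j)
  prefixWalk N       c c-step zero    = stop (zero , z≤n , refl)
  prefixWalk (suc N) c c-step (suc j) = step (zero , z≤n , refl) (c-step zero)
    (weaken (λ (m , m≤j , eq) → suc m , s≤s m≤j , eq) (prefixWalk N (c ∘ suc) (c-step ∘ suc) j))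

  suffixWalk : ∀ N (c : Fin (suc N) → V) → (∀ i → Adj G (c (inject₁ i)) (c (suc i))) → ∀ j →
    Walk G (λ w → ∃[ m ] toℕ j ≤ toℕ m × w ≡ c m) (c j) (c (fromℕ N))
  suffixWalk N       c c-step zero    =
    weaken (λ (m , _ , eq) → m , z≤n , eq) (prefixWalk N c c-step (fromℕ N))
  suffixWalk (suc N) c c-step (suc j) =
    weaken (λ (m , j≤m , eq) → suc m , s≤s j≤m , eq) (suffixWalk N (c ∘ suc) (c-step ∘ suc) j)

  record Detour (C : Cycle G) (i : Fin (3 + Cycle.k C)) : Set where
    open Cycle C
    field
      {next prev} : Fin (3 + Cycle.k C)
      distinct    : vertex next ≢ vertex prev
      to-next     : Adj G (vertex i) (vertex next)
      to-prev     : Adj G (vertex i) (vertex prev)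
      around      : Walk G (λ w → ∃[ m ] m ≢ i × w ≡ vertex m) (vertex next) (vertex prev)

  -- For the first or last vertex, the rest of the cycle is one stretch of the sequence. For an
  -- inner vertex it is the stretch after it, then the closing edge, then the stretch before it.
  detour : ∀ C i → Detour C i
  detour C i = go i
    where
    open Cycle C renaming (step to C-step)
    pre = prefixWalk (2 + k) vertex C-step
    suf = suffixWalk (2 + k) vertex C-step

    after : ∀ {i j : Fin (3 + k)} → toℕ j < toℕ i →
      ∀ {w} → (∃[ m ] toℕ i ≤ toℕ m × w ≡ vertex m) → ∃[ m ] m ≢ j × w ≡ vertex m
    after j<i (m , i≤m , eq) = m , (λ { refl → <-irrefl refl (≤-trans j<i i≤m) }) , eq

    before : ∀ {i j : Fin (3 + k)} → toℕ i < toℕ j →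
      ∀ {w} → (∃[ m ] toℕ m ≤ toℕ i × w ≡ vertex m) → ∃[ m ] m ≢ j × w ≡ vertex m
    before i<j (m , m≤i , eq) = m , (λ { refl → <-irrefl refl (≤-trans (s≤s m≤i) i<j) }) , eq

    inject₁<suc : (j : Fin (2 + k)) → toℕ (inject₁ j) < suc (toℕ j)
    inject₁<suc j = s≤s (≤-reflexive (toℕ-inject₁ j))

    go : ∀ i → Detour C i
    go zero = record
      { distinct = λ eq → case injective eq of λ ()
      ; to-next = C-step zero ; to-prev = symm G close
      ; around = weaken (after (s≤s z≤n)) (suf (suc zero)) }
    go (suc i) with view i
    ... | ‵fromℕ = record
      { distinct = λ eq → case injective eq of λ ()
      ; to-next = close ; to-prev = symm G (C-step (fromℕ (suc k)))
      ; around = weaken (before (inject₁<suc (fromℕ (suc k)))) (pre (inject₁ (fromℕ (suc k)))) }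
    ... | ‵inject₁ j = record
      { distinct = λ eq → ≢ (cong toℕ (injective eq))
      ; to-next = C-step (suc j) ; to-prev = symm G (C-step (inject₁ j))
      ; around = weaken (after (s≤s (s≤s (≤-reflexive (toℕ-inject₁ j))))) (suf (suc (suc j)))
                   ▷⟨ close ⟩ weaken (before (inject₁<suc (inject₁ j))) (pre (inject₁ (inject₁ j))) }
      where
      ≢ : 2 + toℕ j ≢ toℕ (inject₁ (inject₁ j))
      ≢ eq = <-irrefl (sym (trans eq (trans (toℕ-inject₁ (inject₁ j)) (toℕ-inject₁ j)))) (m≤n⇒m≤1+n (n<1+n _))

-- A vertex of least rank on a cycle has two neighbours on it, of no smaller rank.
ranked⇒forest : ∀ (G : Graph V) (rank : V → ℕ) →
  (∀ {x p q} → Adj G x p → Adj G x q → rank x ≤ rank p → rank x ≤ rank q → p ≡ q) → IsForest G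
ranked⇒forest G rank unique C = descend zero (<-wellFounded _)
  where
  open Cycle C
  descend : ∀ i → Acc _<_ (rank (vertex i)) → ⊥
  descend i (acc rec) = go
    where
    open Detour (detour C i)
    go : ⊥
    go with rank (vertex i) ≤? rank (vertex next) | rank (vertex i) ≤? rank (vertex prev)
    ... | no i≰n  | _       = descend next (rec (≰⇒> i≰n))
    ... | _       | no i≰p  = descend prev (rec (≰⇒> i≰p))
    ... | yes i≤n | yes i≤p = distinct (unique to-next to-prev i≤n i≤p)

∃-≡ : ∀ {T : Subset n} {x y : ∃[ v ] v ∈ T} → proj₁ x ≡ proj₁ y → x ≡ y
∃-≡ {x = v , p} {y = .v , q} refl = cong (v ,_) ([]=-irrelevant p q)

-- Induced subgraphs

-- Induced copies as injections compose and make sense for any vertex types, unlike the subsets in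
-- the definition of `Free`; the conversions follow.
record Embedding (H : Graph V) (G : Graph W) : Set where
  field
    to        : V → W
    injective : Injective _≡_ _≡_ to
    adj       : ∀ u v → Adj H u v ⇔ Adj G (to u) (to v)

≅-embedding : ∀ {U V W : Set} {H : Graph U} {X : Graph V} {G : Graph W} → H ≅ X → Embedding X G → Embedding H G
≅-embedding (φ , φ-adj) e = record
  { to        = to ∘ Inverse.to φ
  ; injective = λ eq → trans (sym (Inverse.strictlyInverseʳ φ _))
      (trans (cong (Inverse.from φ) (injective eq)) (Inverse.strictlyInverseʳ φ _))
  ; adj       = λ u v → adj (Inverse.to φ u) (Inverse.to φ v) ⇔-∘ φ-adj u v
  }
  where open Embedding e

embedding⇒induced : {H : Graph (Fin m)} {G : Graph (Fin n)} → Embedding H G → ∃[ S ] H ≅ G [ S ]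
embedding⇒induced e = ⟦ image? ⟧ ,
  mk↔ₛ′ (λ i → to i , ∈⟦⟧⁺ image? (i , refl)) (λ (_ , v∈) → proj₁ (∈⟦⟧⁻ image? v∈))
    (λ (_ , v∈) → ∃-≡ (proj₂ (∈⟦⟧⁻ image? v∈))) (λ i → injective (proj₂ (∈⟦⟧⁻ image? (∈⟦⟧⁺ image? (i , refl))))) ,
  adj
  where
  open Embedding e
  image? : Decidable λ v → ∃[ i ] to i ≡ v
  image? v = any? λ i → to i ≟ v

induced⇒embedding : {H : Graph (Fin m)} {G : Graph (Fin n)} → ∃[ S ] H ≅ G [ S ] → Embedding H G
induced⇒embedding {G = G} (S , H≅G[S]) = ≅-embedding {X = G [ S ]} H≅G[S] record
  { to = proj₁ ; injective = ∃-≡ ; adj = λ _ _ → mk⇔ id id }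

free⇒¬embedding : {H : Graph (Fin m)} {X : Graph V} {G : Graph (Fin n)} →
  H ≅ X → Free G H → ¬ Embedding X G
free⇒¬embedding {H = H} {X} {G} H≅X free e = free (embedding⇒induced {H = H} {G} (≅-embedding {X = X} H≅X e))

-- The three vertices are distinct automatically: if `v` were an end of the edge, it would be
-- adjacent to the other end.
P₁+P₂-embedding : ∀ (G : Graph V) {u v w} → Adj G u w → ¬ Adj G v u → ¬ Adj G v w → Embedding (P 1 ⊕ P 2) G
P₁+P₂-embedding {V} G {u} {v} {w} u~w v≁u v≁w = record { to = to ; injective = inj ; adj = adj }
  where
  to : Fin 1 ⊎ Fin 2 → V
  to (inj₁ zero)       = v
  to (inj₂ zero)       = u
  to (inj₂ (suc zero)) = w

  v≢u : v ≢ u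
  v≢u refl = v≁w u~w
  v≢w : v ≢ w
  v≢w refl = v≁u (symm G u~w)
  u≢w : u ≢ w
  u≢w eq = irrefl G eq u~w

  inj : Injective _≡_ _≡_ to
  inj {inj₁ zero}       {inj₁ zero}       _  = refl
  inj {inj₁ zero}       {inj₂ zero}       eq = contradiction eq v≢u
  inj {inj₁ zero}       {inj₂ (suc zero)} eq = contradiction eq v≢w
  inj {inj₂ zero}       {inj₁ zero}       eq = contradiction (sym eq) v≢u
  inj {inj₂ zero}       {inj₂ zero}       _  = refl
  inj {inj₂ zero}       {inj₂ (suc zero)} eq = contradiction eq u≢w
  inj {inj₂ (suc zero)} {inj₁ zero}       eq = contradiction (sym eq) v≢w
  inj {inj₂ (suc zero)} {inj₂ zero}       eq = contradiction (sym eq) u≢w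
  inj {inj₂ (suc zero)} {inj₂ (suc zero)} _  = refl

  adj : ∀ x y → Adj (P 1 ⊕ P 2) x y ⇔ Adj G (to x) (to y)
  adj (inj₁ zero) (inj₁ zero) =
    mk⇔ (λ { (inj₁ (inj₁ ())) ; (inj₁ (inj₂ ())) }) (λ e → contradiction e (irrefl G refl))
  adj (inj₁ zero) (inj₂ zero) = mk⇔ (λ ()) (λ e → contradiction e v≁u)
  adj (inj₁ zero) (inj₂ (suc zero)) = mk⇔ (λ ()) (λ e → contradiction e v≁w)
  adj (inj₂ zero) (inj₁ zero) = mk⇔ (λ ()) (λ e → contradiction (symm G e) v≁u)
  adj (inj₂ (suc zero)) (inj₁ zero) = mk⇔ (λ ()) (λ e → contradiction (symm G e) v≁w)
  adj (inj₂ zero) (inj₂ zero) =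
    mk⇔ (λ { (inj₂ (inj₁ ())) ; (inj₂ (inj₂ ())) }) (λ e → contradiction e (irrefl G refl))
  adj (inj₂ zero) (inj₂ (suc zero)) = mk⇔ (λ _ → u~w) (λ _ → inj₂ (inj₁ refl))
  adj (inj₂ (suc zero)) (inj₂ zero) = mk⇔ (λ _ → symm G u~w) (λ _ → inj₂ (inj₂ refl))
  adj (inj₂ (suc zero)) (inj₂ (suc zero)) =
    mk⇔ (λ { (inj₂ (inj₁ ())) ; (inj₂ (inj₂ ())) }) (λ e → contradiction e (irrefl G refl))

star-embedding : ∀ (G : Graph V) {r} (c : V) (leaf : Fin r → V) → Injective _≡_ _≡_ leaf →
  (∀ i → Adj G c (leaf i)) → (∀ i j → ¬ Adj G (leaf i) (leaf j)) → Embedding (K 1 r) G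
star-embedding {V} G {r} c leaf leaf-injective c~leaf independent =
  record { to = to ; injective = inj ; adj = adj }
  where
  to : Fin 1 ⊎ Fin r → V
  to (inj₁ _) = c
  to (inj₂ i) = leaf i

  inj : Injective _≡_ _≡_ to
  inj {inj₁ zero} {inj₁ zero} _  = refl
  inj {inj₁ zero} {inj₂ j}    eq = contradiction (c~leaf j) (irrefl G eq)
  inj {inj₂ i}    {inj₁ zero} eq = contradiction (c~leaf i) (irrefl G (sym eq))
  inj {inj₂ i}    {inj₂ j}    eq = cong inj₂ (leaf-injective eq)

  adj : ∀ u v → Adj (K 1 r) u v ⇔ Adj G (to u) (to v)
  adj (inj₁ _) (inj₁ _) = mk⇔ (λ ()) (irrefl G refl)
  adj (inj₁ _) (inj₂ j) = mk⇔ (λ _ → c~leaf j) _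
  adj (inj₂ i) (inj₁ _) = mk⇔ (λ _ → symm G (c~leaf i)) _
  adj (inj₂ i) (inj₂ j) = mk⇔ (λ ()) (independent i j)

choose : ∀ (U T : Subset n) → s + ∣ T ∣ ≤ ∣ U ∣ →
  Σ (Fin s → Fin n) λ g → Injective _≡_ _≡_ g × (∀ i → g i ∈ U) × (∀ i → g i ∉ T)
choose {s = s} U T s+∣T∣≤∣U∣ = enum (U ─ T) ∘ inj ,
  (λ eq → inject≤-injective s≤ s≤ _ _ (enum-injective (U ─ T) eq)) ,
  (λ i → p─q⊆p U T (enum-∈ (U ─ T) (inj i))) ,
  (λ i → x∈p─q⇒x∉q U T (enum-∈ (U ─ T) (inj i)))
  where
  s≤ : s ≤ ∣ U ─ T ∣
  s≤ = +-cancelˡ-≤ ∣ T ∣ _ _ (≤-trans (≤-reflexive (+-comm ∣ T ∣ s)) (≤-trans s+∣T∣≤∣U∣ (∣p∣≤∣q∣+∣p─q∣ U T)))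
  inj = λ i → inject≤ i s≤

-- Short cycles and criteria for feedback vertex sets

module _ (G : Graph (Fin n)) {T : Subset n} (fvs : IsFVS G T) where

  noTriangle : ∀ {x y z} → x ∉ T → y ∉ T → z ∉ T → Adj G x y → Adj G y z → Adj G x z → ⊥
  noTriangle x∉ y∉ z∉ xy yz xz = fvs (closeWalk G T x∉ (λ y≡z → irrefl G y≡z yz) xy xz
    (step (y∉ , (λ y≡x → irrefl G (sym y≡x) xy)) yz (stop (z∉ , (λ z≡x → irrefl G (sym z≡x) xz)))))

  -- Consecutive corners differ because they are adjacent, opposite ones by assumption. Chords are
  -- harmless, as a forest has no cycle at all, induced or not.
  noSquare : ∀ {w x y z} → w ∉ T → x ∉ T → y ∉ T → z ∉ T → w ≢ y → x ≢ z →
    Adj G w x → Adj G x y → Adj G y z → Adj G z w → ⊥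
  noSquare w∉ x∉ y∉ z∉ w≢y x≢z wx xy yz zw = fvs (closeWalk G T w∉ x≢z wx (symm G zw)
    (step (x∉ , λ x≡w → irrefl G (sym x≡w) wx) xy
      (step (y∉ , λ y≡w → w≢y (sym y≡w)) yz (stop (z∉ , λ z≡w → irrefl G z≡w zw)))))

ranked⇒fvs : ∀ (G : Graph (Fin n)) (T : Subset n) (rank : Fin n → ℕ) →
  (∀ {x p q} → x ∉ T → p ∉ T → q ∉ T → Adj G x p → Adj G x q → rank x ≤ rank p → rank x ≤ rank q → p ≡ q) →
  IsFVS G T
ranked⇒fvs G T rank unique = ranked⇒forest (G [ ∁ T ]) (rank ∘ proj₁)
  λ { {_ , x∈} {_ , p∈} {_ , q∈} xp xq x≤p x≤q →
      ∃-≡ (unique (x∈∁p⇒x∉p x∈) (x∈∁p⇒x∉p p∈) (x∈∁p⇒x∉p q∈) xp xq x≤p x≤q) }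

-- With rank 1 for `c` and rank 0 elsewhere, any other vertex outside `T` has `c` as its only
-- possible neighbour there, while all neighbours of `c` have smaller rank.
star⇒fvs : ∀ (G : Graph (Fin n)) (T : Subset n) (c : Fin n) →
  (∀ {u v} → u ∉ T → v ∉ T → Adj G u v → u ≡ c ⊎ v ≡ c) → IsFVS G T
star⇒fvs {n = n} G T c centre = ranked⇒fvs G T rank unique
  where
  rank : Fin n → ℕ
  rank v with v ≟ c
  ... | yes _ = 1
  ... | no _  = 0

  unique : ∀ {x p q} → x ∉ T → p ∉ T → q ∉ T → Adj G x p → Adj G x q → rank x ≤ rank p → rank x ≤ rank q → p ≡ q
  unique {x} {p} x∉ p∉ q∉ xp xq x≤p x≤q with centre x∉ p∉ xp | centre x∉ q∉ xq
  ... | inj₂ refl | inj₂ refl = refl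
  ... | inj₂ refl | inj₁ refl = contradiction xp (irrefl G refl)
  ... | inj₁ refl | _ with x ≟ x | p ≟ x
  ...   | _      | yes refl = contradiction xp (irrefl G refl)
  ...   | no x≢x | _        = contradiction refl x≢x
  unique {x} {p} x∉ p∉ q∉ xp xq () x≤q | inj₁ refl | _ | yes _ | no _

-- An independent feedback vertex set itself induces an edgeless graph, so `r` of its vertices would
-- form the forbidden copy.
edgeless-bound : ∀ (G : Graph (Fin n)) r → ¬ Embedding (edgeless r) G →
  ∀ {b} → Ifvs≡ G b → b ≤ r
edgeless-bound G r ¬e ((I , (_ , ind) , refl) , _) with r ≤? ∣ I ∣
... | no r≰I  = ≰⇒≥ r≰I
... | yes r≤I = contradiction e ¬e
  where
  e : Embedding (edgeless r) G
  e = record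
    { to        = λ i → enum I (inject≤ i r≤I)
    ; injective = λ eq → inject≤-injective r≤I r≤I _ _ (enum-injective I eq)
    ; adj       = λ u v → mk⇔ (λ ()) (ind _ _ (enum-∈ I _) (enum-∈ I _))
    }

-- (P₁ + P₂)-free graphs

module CompleteMultipartite (G : Graph (Fin n)) (free : ¬ Embedding (P 1 ⊕ P 2) G) where

  -- Otherwise the edge `u w` and the vertex `v` would induce `P₁ + P₂`. Non-adjacency is thus an
  -- equivalence relation, whose classes are the parts.
  nonAdj-trans : ∀ {u v w} → ¬ Adj G u v → ¬ Adj G v w → ¬ Adj G u w
  nonAdj-trans u≁v v≁w u~w = free (P₁+P₂-embedding G u~w (λ e → u≁v (symm G e)) v≁w)

  -- If I has two vertices x, y outside T, then all but at most one vertex outside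
  -- the part of x and y lie in T: two more would close a 4-cycle with x and y.
  bound : ∀ {a b} → Fvs≡ G a → Ifvs≡ G b → b ≤ suc a
  bound ((T , T-fvs , refl) , _) ((I , (I-fvs , I-ind) , refl) , minimal) with 2 + ∣ T ∣ ≤? ∣ I ∣
  ... | no ≰∣I∣ = s≤s⁻¹ (≰⇒> ≰∣I∣)
  ... | yes ≤∣I∣ with choose I T ≤∣I∣
  ... | g , g-inj , g∈I , g∉T = large
    where
    x = g zero
    y = g (suc zero)
    x≢y : x ≢ y
    x≢y eq = case g-inj eq of λ ()

    -- The non-adjacent `x` and `y` share a part, and `D` is the union of all other parts. It is
    -- disjoint from `I`, and its complement is independent.
    D : Subset n
    D = ⟦ adj? G x ⟧

    D-nbr : ∀ {z} → z ∈ D → Adj G x z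
    D-nbr = ∈⟦⟧⁻ (adj? G x)

    ∉D : ∀ {z} → z ∉ D → ¬ Adj G x z
    ∉D z∉ xz = z∉ (∈⟦⟧⁺ (adj? G x) xz)

    D∉I : ∀ {z} → z ∈ D → z ∉ I
    D∉I z∈D z∈I = I-ind _ _ (g∈I zero) z∈I (D-nbr z∈D)

    D-nbr-y : ∀ {z} → z ∈ D → Adj G z y
    D-nbr-y {z} z∈D = decidable-stable (adj? G z y) λ z≁y →
      nonAdj-trans z≁y (I-ind _ _ (g∈I (suc zero)) (g∈I zero)) (symm G (D-nbr z∈D))

    ∣D∣≤ : ∣ D ∣ ≤ suc ∣ T ∣
    ∣D∣≤ with 2 + ∣ T ∣ ≤? ∣ D ∣
    ... | no ≰∣D∣ = s≤s⁻¹ (≰⇒> ≰∣D∣)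
    ... | yes ≤∣D∣ with choose D T ≤∣D∣
    ... | h , h-inj , h∈D , h∉T = ⊥-elim (noSquare G T-fvs
      (g∉T zero) (h∉T zero) (g∉T (suc zero)) (h∉T (suc zero)) x≢y (λ eq → case h-inj eq of λ ())
      (D-nbr (h∈D zero)) (D-nbr-y (h∈D zero)) (symm G (D-nbr-y (h∈D (suc zero)))) (symm G (D-nbr (h∈D (suc zero)))))

    outside-D : ∀ {u v} → u ∉ D → v ∉ D → ¬ Adj G u v
    outside-D u∉ v∉ = nonAdj-trans (λ e → ∉D u∉ (symm G e)) (∉D v∉)

    -- Then `D - c` can compete with `I`: an edge inside it would form a triangle with `c` in
    -- `G - I`, and what remains after its deletion is a star, the part of `x` with centre `c`.
    centred : ∀ {c} → c ∈ D → (∀ z → z ∈ D → z ≢ c → Adj G z c) → ∣ I ∣ ≤ suc ∣ T ∣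
    centred {c} c∈D nbr = ≤-trans (minimal (D - c) (D-c-fvs , D-c-ind)) (≤-trans (<⇒≤ (x∈p⇒∣p-x∣<∣p∣ c∈D)) ∣D∣≤)
      where
      ∈D : ∀ {u} → u ∈ D - c → u ∈ D
      ∈D = p─q⊆p D ⁅ c ⁆
      ≢c : ∀ {u} → u ∈ D - c → u ≢ c
      ≢c u∈ refl = x∈p─q⇒x∉q D ⁅ c ⁆ u∈ (x∈⁅x⁆ c)
      D-c-ind : IsIndependent G (D - c)
      D-c-ind u v u∈ v∈ uv = noTriangle G I-fvs (D∉I (∈D u∈)) (D∉I (∈D v∈)) (D∉I c∈D) uv
        (nbr v (∈D v∈) (≢c v∈)) (nbr u (∈D u∈) (≢c u∈))
      D-c-fvs : IsFVS G (D - c)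
      D-c-fvs = star⇒fvs G (D - c) c centre
        where
        centre : ∀ {u v} → u ∉ D - c → v ∉ D - c → Adj G u v → u ≡ c ⊎ v ≡ c
        centre {u} {v} u∉ v∉ uv with u ≟ c | v ≟ c
        ... | yes u≡c | _       = inj₁ u≡c
        ... | _       | yes v≡c = inj₂ v≡c
        ... | no u≢c  | no v≢c  = contradiction uv
          (outside-D (λ u∈ → u∉ (x∈p∧x≢y⇒x∈p-y u∈ u≢c)) (λ v∈ → v∉ (x∈p∧x≢y⇒x∈p-y v∈ v≢c)))

    centre? : ∀ p → Dec (∃[ r ] r ∈ D × r ≢ p × ¬ Adj G r p)
    centre? p = any? λ r → (r ∈? D) ×-dec ¬? (r ≟ p) ×-dec ¬? (adj? G r p)

    isCentre : ∀ {p} → ¬ (∃[ r ] r ∈ D × r ≢ p × ¬ Adj G r p) → ∀ z → z ∈ D → z ≢ p → Adj G z p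
    isCentre {p} none z z∈ z≢p = decidable-stable (adj? G z p) λ z≁p → none (z , z∈ , z≢p , z≁p)

    -- Being disjoint from `I`, the set `D` induces a forest, and a complete multipartite forest is
    -- edgeless or a star. So `D`, or `D` without a centre, is an independent feedback vertex set.
    large : ∣ I ∣ ≤ suc ∣ T ∣
    large with any? (λ p → any? λ q → (p ∈? D) ×-dec (q ∈? D) ×-dec adj? G p q)
    ... | no independent = ≤-trans (minimal D
            ( star⇒fvs G D x (λ u∉ v∉ uv → contradiction uv (outside-D u∉ v∉))
            , λ u v u∈ v∈ uv → independent (u , v , u∈ , v∈ , uv))) ∣D∣≤
    ... | yes (p , q , p∈ , q∈ , pq) with centre? p | centre? q
    ... | no none | _ = centred p∈ (isCentre none)
    ... | _ | no none = centred q∈ (isCentre none)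
    -- Here `r` lies in the part of `p` and `r′` in that of `q`; distinct parts are completely
    -- joined, so `p q r r′` is a 4-cycle of `G - I`.
    ... | yes (r , r∈ , r≢p , r≁p) | yes (r′ , r′∈ , r′≢q , r′≁q) = ⊥-elim (noSquare G I-fvs
        (D∉I p∈) (D∉I q∈) (D∉I r∈) (D∉I r′∈) (λ eq → r≢p (sym eq)) (λ eq → r′≢q (sym eq)) pq qr rr′ r′p)
      where
      qr : Adj G q r
      qr = decidable-stable (adj? G q r) λ q≁r → nonAdj-trans q≁r r≁p (symm G pq)
      r′p : Adj G r′ p
      r′p = decidable-stable (adj? G r′ p) λ r′≁p →
        nonAdj-trans (λ e → r′≁p (symm G e)) r′≁q pq
      rr′ : Adj G r r′
      rr′ = decidable-stable (adj? G r r′) λ r≁r′ →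
        nonAdj-trans (λ e → r≁r′ (symm G e)) r≁p r′p

-- K₁,ᵣ-free graphs

record IndependentFamily (G : Graph (Fin n)) (U : Subset n) (s : ℕ) : Set where
  field
    member      : Fin s → Fin n
    injective   : Injective _≡_ _≡_ member
    member-∈    : ∀ i → member i ∈ U
    independent : ∀ i j → ¬ Adj G (member i) (member j)

-- Greedy choice: a vertex of U has r neighbours in U, which are independent,
-- or it can be taken and its closed neighbourhood of size at most r discarded.
greedy : ∀ (G : Graph (Fin n)) r s (U : Subset n) →
  (∀ {x y z} → x ∈ U → y ∈ U → z ∈ U → Adj G x y → Adj G y z → Adj G x z → ⊥) →
  s * r ≤ ∣ U ∣ → IndependentFamily G U s ⊎ IndependentFamily G U r
greedy G r zero U noTriangleᵁ _ = inj₁ record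
  { member = λ () ; injective = λ { {()} } ; member-∈ = λ () ; independent = λ () }
-- For `r = 0` the set `U` may be empty, so there may be no vertex to take, but the empty family
-- serves as the second alternative.
greedy G zero (suc s) U noTriangleᵁ _ = inj₂ record
  { member = λ () ; injective = λ { {()} } ; member-∈ = λ () ; independent = λ () }
greedy {n = n} G r@(suc _) (suc s) U noTriangleᵁ large = choice
  where
  v : Fin n
  v = enum U (inject≤ zero (≤-trans (m≤m+n r (s * r)) large))

  v∈U : v ∈ U
  v∈U = enum-∈ U _

  nbr? : Decidable λ u → u ∈ U × Adj G v u
  nbr? u = (u ∈? U) ×-dec adj? G v u

  closed? : Decidable λ u → u ≡ v ⊎ Adj G v u
  closed? u = (u ≟ v) ⊎-dec adj? G v u

  rest : Subset n
  rest = U ─ ⟦ closed? ⟧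

  open IndependentFamily

  extend : IndependentFamily G rest s → IndependentFamily G U (suc s)
  extend F = record
    { member      = mem
    ; injective   = inj
    ; member-∈    = λ { zero → v∈U ; (suc i) → p─q⊆p U _ (member-∈ F i) }
    ; independent = ind
    }
    where
    mem : Fin (suc s) → Fin n
    mem zero    = v
    mem (suc i) = member F i

    away : ∀ i → ¬ (member F i ≡ v ⊎ Adj G v (member F i))
    away i c = x∈p─q⇒x∉q U ⟦ closed? ⟧ (member-∈ F i) (∈⟦⟧⁺ closed? c)

    inj : Injective _≡_ _≡_ mem
    inj {zero}  {zero}  _  = refl
    inj {zero}  {suc j} eq = contradiction (inj₁ (sym eq)) (away j)
    inj {suc i} {zero}  eq = contradiction (inj₁ eq) (away i)
    inj {suc i} {suc j} eq = cong suc (injective F eq)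

    ind : ∀ i j → ¬ Adj G (mem i) (mem j)
    ind zero    zero    e = irrefl G refl e
    ind zero    (suc j) e = away j (inj₂ e)
    ind (suc i) zero    e = away i (inj₂ (symm G e))
    ind (suc i) (suc j) e = independent F i j e

  enlarge : IndependentFamily G rest r → IndependentFamily G U r
  enlarge F = record { member = member F ; injective = injective F
    ; member-∈ = λ i → p─q⊆p U _ (member-∈ F i) ; independent = independent F }

  choice : IndependentFamily G U (suc s) ⊎ IndependentFamily G U r
  choice with r ≤? ∣ ⟦ nbr? ⟧ ∣
  ... | yes r≤ = inj₂ record
    { member      = λ i → enum ⟦ nbr? ⟧ (inject≤ i r≤)
    ; injective   = λ eq → inject≤-injective r≤ r≤ _ _ (enum-injective ⟦ nbr? ⟧ eq)
    ; member-∈    = λ i → proj₁ (∈nbr i)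
    ; independent = λ i j e →
        noTriangleᵁ v∈U (proj₁ (∈nbr i)) (proj₁ (∈nbr j)) (proj₂ (∈nbr i)) e (proj₂ (∈nbr j))
    }
    where
    ∈nbr : ∀ i → _
    ∈nbr i = ∈⟦⟧⁻ nbr? (enum-∈ ⟦ nbr? ⟧ (inject≤ i r≤))
  ... | no r≰ with greedy G r s rest
                     (λ x∈ y∈ z∈ → noTriangleᵁ (p─q⊆p U _ x∈) (p─q⊆p U _ y∈) (p─q⊆p U _ z∈)) rest-large
    where
    open ≤-Reasoning
    closedᵁ : Subset n
    closedᵁ = U ─ rest

    closed-small : ∣ closedᵁ ∣ ≤ r
    closed-small = begin
      ∣ closedᵁ ∣                        ≤⟨ ∣p∣≤∣q∣+∣p─q∣ closedᵁ ⁅ v ⁆ ⟩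
      ∣ ⁅ v ⁆ ∣ + ∣ closedᵁ ─ ⁅ v ⁆ ∣    ≤⟨ +-mono-≤ (≤-reflexive (∣⁅x⁆∣≡1 v)) (p⊆q⇒∣p∣≤∣q∣ sub) ⟩
      suc ∣ ⟦ nbr? ⟧ ∣                   ≤⟨ ≰⇒> r≰ ⟩
      r                                  ∎
      where
      sub : closedᵁ ─ ⁅ v ⁆ ⊆ ⟦ nbr? ⟧
      sub {u} u∈ with closed? u
      ... | yes (inj₁ refl) = contradiction (x∈⁅x⁆ u) (x∈p─q⇒x∉q closedᵁ ⁅ u ⁆ u∈)
      ... | yes (inj₂ vu)   = ∈⟦⟧⁺ nbr? (p─q⊆p U rest (p─q⊆p closedᵁ ⁅ v ⁆ u∈) , vu)
      ... | no far          = contradiction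
            (x∈p∧x∉q⇒x∈p─q (p─q⊆p U rest (p─q⊆p closedᵁ ⁅ v ⁆ u∈)) (λ u∈′ → far (∈⟦⟧⁻ closed? u∈′)))
            (x∈p─q⇒x∉q U rest (p─q⊆p closedᵁ ⁅ v ⁆ u∈))

    rest-large : s * r ≤ ∣ rest ∣
    rest-large = +-cancelˡ-≤ r _ _ (begin
      r + s * r               ≤⟨ large ⟩
      ∣ U ∣                   ≤⟨ ∣p∣≤∣q∣+∣p─q∣ U rest ⟩
      ∣ rest ∣ + ∣ closedᵁ ∣  ≤⟨ +-monoʳ-≤ ∣ rest ∣ closed-small ⟩
      ∣ rest ∣ + r            ≡⟨ +-comm ∣ rest ∣ r ⟩
      r + ∣ rest ∣            ∎)
  ... | inj₁ F = inj₁ (extend F)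
  ... | inj₂ F = inj₂ (enlarge F)

-- Here `M` bounds the closed neighbourhood of a feedback vertex set of size `a`, and `M * M` the
-- number of pairs of portal ends in it.
starBound : ℕ → ℕ → ℕ
starBound r a = M + M * M
  where M = a * (a + r * r)

module StarFree (G : Graph (Fin n)) (r : ℕ) (free : ¬ Embedding (K 1 r) G)
  (T : Subset n) (T-fvs : IsFVS G T) where

  closed? : ∀ t → Decidable λ v → v ≡ t ⊎ Adj G t v
  closed? t v = (v ≟ t) ⊎-dec adj? G t v

  -- The neighbours of `t` outside `T` span no triangle. If there were `r * r` of them, the greedy
  -- choice would find `r` independent ones, which form `K₁,ᵣ` with `t`.
  closed-bound : ∀ {t} → t ∈ T → ∣ ⟦ closed? t ⟧ ∣ ≤ ∣ T ∣ + r * r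
  closed-bound {t} t∈T = ≤-trans (∣p∣≤∣q∣+∣p─q∣ ⟦ closed? t ⟧ T) (+-monoʳ-≤ ∣ T ∣ bounded)
    where
    U = ⟦ closed? t ⟧ ─ T

    ∉T : ∀ {u} → u ∈ U → u ∉ T
    ∉T = x∈p─q⇒x∉q ⟦ closed? t ⟧ T

    nbr : ∀ {u} → u ∈ U → Adj G t u
    nbr u∈ with ∈⟦⟧⁻ (closed? t) (p─q⊆p ⟦ closed? t ⟧ T u∈)
    ... | inj₁ refl = contradiction t∈T (∉T u∈)
    ... | inj₂ tu   = tu

    star : IndependentFamily G U r → Embedding (K 1 r) G
    star F = star-embedding G t member injective (λ i → nbr (member-∈ i)) independent
      where open IndependentFamily F

    bounded : ∣ U ∣ ≤ r * r
    bounded with r * r ≤? ∣ U ∣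
    ... | no ≰   = ≰⇒≥ ≰
    ... | yes ≤U = case greedy G r r U (λ x∈ y∈ z∈ → noTriangle G T-fvs (∉T x∈) (∉T y∈) (∉T z∈)) ≤U of λ where
      (inj₁ F) → contradiction (star F) free
      (inj₂ F) → contradiction (star F) free

  near? : Decidable λ v → ∃[ t ] t ∈ T × (v ≡ t ⊎ Adj G t v)
  near? v = any? λ t → (t ∈? T) ×-dec closed? t v

  N : Subset n
  N = ⟦ near? ⟧

  T⊆N : T ⊆ N
  T⊆N {t} t∈T = ∈⟦⟧⁺ near? (t , t∈T , inj₁ refl)

  N-bound : ∣ N ∣ ≤ ∣ T ∣ * (∣ T ∣ + r * r)
  N-bound = ∣∣-≤ N (λ v∈ → code (∈⟦⟧⁻ near? v∈)) (λ u∈ v∈ → code-injective (∈⟦⟧⁻ near? u∈) (∈⟦⟧⁻ near? v∈))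
    where
    code : ∀ {v} → (∃[ t ] t ∈ T × (v ≡ t ⊎ Adj G t v)) → Fin (∣ T ∣ * (∣ T ∣ + r * r))
    code (t , t∈ , c) = combine (index T t∈) (inject≤ (index ⟦ closed? t ⟧ (∈⟦⟧⁺ (closed? t) c)) (closed-bound t∈))

    code-injective : ∀ {u v} p q → code {u} p ≡ code {v} q → u ≡ v
    code-injective (t , t∈ , c) (t′ , t′∈ , c′) eq with combine-injective (index T t∈) _ (index T t′∈) _ eq
    ... | eq₁ , eq₂ with index-injective T t∈ t′∈ eq₁
    ... | refl = index-injective ⟦ closed? t ⟧ _ _ (inject≤-injective (closed-bound t∈) (closed-bound t′∈) _ _ eq₂)

  -- Portals of the vertices of a minimum independent feedback vertex set

  module Minimal (I : Subset n) (I-fvs : IsFVS G I) (I-ind : IsIndependent G I)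
    (minimal : ∀ S → IsIFVS G S → ∣ I ∣ ≤ ∣ S ∣) where

    Avoiding : Fin n → Set
    Avoiding w = w ∉ I × w ∉ T

    -- By minimality v lies on a cycle which meets I in v only.  Followed from v
    -- in both directions until it is about to enter T, it gives a portal of v.
    record Portal (v : Fin n) : Set where
      field
        {p q x y} : Fin n
        p≢q       : p ≢ q
        vp        : Adj G v p
        vq        : Adj G v q
        x∈N       : x ∈ N
        y∈N       : y ∈ N
        p⇝x       : Walk G Avoiding p x
        q⇝y       : Walk G Avoiding q y

    -- When the next vertex of the walk is in `T`, the current one is adjacent to `T` and therefore
    -- belongs to `N`.
    untilT : ∀ {p q} → p ∉ T → Walk G (_∉ I) p q →
      Walk G Avoiding p q ⊎ ∃[ x ] x ∈ N × Walk G Avoiding p x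
    untilT p∉T (stop p∉I) = inj₁ (stop (p∉I , p∉T))
    untilT {p} p∉T (step {y = p′} p∉I e w) with p′ ∈? T
    ... | yes p′∈T = inj₂ (p , ∈⟦⟧⁺ near? (p′ , p′∈T , inj₂ (symm G e)) , stop (p∉I , p∉T))
    ... | no p′∉T with untilT p′∉T w
    ...   | inj₁ w′            = inj₁ (step (p∉I , p∉T) e w′)
    ...   | inj₂ (x , x∈N , w′) = inj₂ (x , x∈N , step (p∉I , p∉T) e w′)

    ∉N⇒∉T : ∀ {v} → v ∉ N → v ∉ T
    ∉N⇒∉T v∉N v∈T = v∉N (T⊆N v∈T)

    nbr∉T : ∀ {v p} → v ∉ N → Adj G v p → p ∉ T
    nbr∉T v∉N vp p∈T = v∉N (∈⟦⟧⁺ near? (_ , p∈T , inj₂ (symm G vp)))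

    -- Without a portal, `I - v` would still be an independent feedback vertex set, against
    -- minimality. That argument refutes every cycle instead of producing one, hence the double
    -- negation.
    portal : ∀ v → v ∈ I → v ∉ N → ¬ ¬ Portal v
    portal v v∈I v∉N ¬portal = ≤⇒≯ (minimal (I - v) (I-v-fvs , I-v-ind)) (x∈p⇒∣p-x∣<∣p∣ v∈I)
      where
      I-v-ind : IsIndependent G (I - v)
      I-v-ind a b a∈ b∈ = I-ind a b (p─q⊆p I ⁅ v ⁆ a∈) (p─q⊆p I ⁅ v ⁆ b∈)

      ∉I : ∀ {w} → w ∈ ∁ (I - v) → w ≢ v → w ∉ I
      ∉I w∈ w≢v w∈I = x∈∁p⇒x∉p w∈ (x∈p∧x≢y⇒x∈p-y w∈I w≢v)

      I-v-fvs : IsFVS G (I - v)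
      I-v-fvs C with any? (λ i → proj₁ (Cycle.vertex C i) ≟ v)
      ... | no v∉C = I-fvs record
        { k         = k
        ; vertex    = λ i → proj₁ (vertex i) , x∉p⇒x∈∁p (∉I (proj₂ (vertex i)) (λ eq → v∉C (i , eq)))
        ; injective = λ eq → injective (∃-≡ (cong proj₁ eq))
        ; step      = Cycle.step C
        ; close     = close
        }
        where open Cycle C
      ... | yes (i , i≡v) = ¬portal (fromWalk (λ eq → distinct (∃-≡ eq))
              (subst (λ u → Adj G u (proj₁ (vertex next))) i≡v to-next)
              (subst (λ u → Adj G u (proj₁ (vertex prev))) i≡v to-prev)
              (mapᵂ proj₁ off-I id around))
        where
        open Cycle C using (vertex; injective)
        open Detour (detour C i)

        off-I : ∀ {w} → (∃[ m ] m ≢ i × w ≡ vertex m) → proj₁ w ∉ I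
        off-I (m , m≢i , refl) = ∉I (proj₂ (vertex m)) λ eq → m≢i (injective (∃-≡ (trans eq (sym i≡v))))

        fromWalk : ∀ {p q} → p ≢ q → Adj G v p → Adj G v q → Walk G (_∉ I) p q → Portal v
        fromWalk p≢q vp vq w with untilT (nbr∉T v∉N vp) w | untilT (nbr∉T v∉N vq) (reverse w)
        ... | inj₂ (_ , x∈N , p⇝x) | inj₂ (_ , y∈N , q⇝y) = record
          { p≢q = p≢q ; vp = vp ; vq = vq ; x∈N = x∈N ; y∈N = y∈N ; p⇝x = p⇝x ; q⇝y = q⇝y }
        -- A traversal that never meets `T` closes up through `v` to a cycle of `G - T`.
        ... | inj₁ w′ | _ = ⊥-elim (T-fvs (closeWalk G T (∉N⇒∉T v∉N) p≢q vp vq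
          (weaken (λ (∉I , ∉T) → ∉T , λ { refl → ∉I v∈I }) w′)))
        ... | _ | inj₁ w′ = ⊥-elim (T-fvs (closeWalk G T (∉N⇒∉T v∉N) (λ eq → p≢q (sym eq)) vq vp
          (weaken (λ (∉I , ∉T) → ∉T , λ { refl → ∉I v∈I }) w′)))

    -- Two vertices with the same portal ends lie on a cycle of G - T.
    portal-injective : ∀ {v w} → v ∈ I → v ∉ N → w ∈ I → w ∉ N → (A : Portal v) (B : Portal w) →
      Portal.x A ≡ Portal.x B → Portal.y A ≡ Portal.y B → v ≡ w
    portal-injective {v} {w} v∈I v∉N w∈I w∉N A B refl refl with v ≟ w
    ... | yes v≡w = v≡w
    ... | no v≢w  = ⊥-elim (T-fvs (closeWalk G T (∉N⇒∉T v∉N) A.p≢q A.vp A.vq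
        -- From `A.p` through the common end `x` to `B.p`, across `w`, then from `B.q` through the
        -- common end `y` to `A.q`. The pieces miss `v` because they avoid `I`.
        ((off A.p⇝x ++ off (reverse B.p⇝x)) ▷⟨ symm G B.vp ⟩
          step (∉N⇒∉T w∉N , λ w≡v → v≢w (sym w≡v)) B.vq
            (off B.q⇝y ++ off (reverse A.q⇝y)))))
      where
      module A = Portal A
      module B = Portal B
      off : ∀ {a b} → Walk G Avoiding a b → Walk G (λ u → u ∉ T × u ≢ v) a b
      off = weaken λ (∉I , ∉T) → ∉T , λ { refl → ∉I v∈I }

    -- The inequality is decidable and hence stable, so the finitely many doubly negated portals can
    -- be gathered and used simultaneously. A vertex is then encoded by its two portal ends.
    I─N-bound : ∣ I ─ N ∣ ≤ ∣ N ∣ * ∣ N ∣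
    I─N-bound = decidable-stable (_ ≤? _) λ ≰ →
      sequence (RawMonad.rawApplicative ¬¬-Monad) portals λ f → ≰ (∣∣-≤ (I ─ N) (code f) (code-injective f))
      where
      ∈I : ∀ {v} → v ∈ I ─ N → v ∈ I
      ∈I = p─q⊆p I N
      ∉N : ∀ {v} → v ∈ I ─ N → v ∉ N
      ∉N = x∈p─q⇒x∉q I N

      portals : ∀ v → ¬ ¬ (v ∈ I ─ N → Portal v)
      portals v with v ∈? (I ─ N)
      ... | no v∉  = λ k → k λ v∈ → contradiction v∈ v∉
      ... | yes v∈ = λ k → portal v (∈I v∈) (∉N v∈) λ A → k λ _ → A

      module _ (f : ∀ v → v ∈ I ─ N → Portal v) where
        code : ∀ {v} → v ∈ I ─ N → Fin (∣ N ∣ * ∣ N ∣)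
        code {v} v∈ = combine (index N (Portal.x∈N (f v v∈))) (index N (Portal.y∈N (f v v∈)))

        code-injective : ∀ {u v} (u∈ : u ∈ I ─ N) (v∈ : v ∈ I ─ N) → code u∈ ≡ code v∈ → u ≡ v
        code-injective u∈ v∈ eq with combine-injective (index N _) _ (index N _) _ eq
        ... | eq₁ , eq₂ = portal-injective (∈I u∈) (∉N u∈) (∈I v∈) (∉N v∈) (f _ u∈) (f _ v∈)
              (index-injective N _ _ eq₁) (index-injective N _ _ eq₂)

    I-bound : ∣ I ∣ ≤ starBound r ∣ T ∣
    I-bound = begin
      ∣ I ∣                    ≤⟨ ∣p∣≤∣q∣+∣p─q∣ I N ⟩
      ∣ N ∣ + ∣ I ─ N ∣        ≤⟨ +-monoʳ-≤ ∣ N ∣ I─N-bound ⟩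
      ∣ N ∣ + ∣ N ∣ * ∣ N ∣    ≤⟨ +-mono-≤ N-bound (*-mono-≤ N-bound N-bound) ⟩
      starBound r ∣ T ∣        ∎
      where open ≤-Reasoning

star-bound : ∀ (G : Graph (Fin n)) r → ¬ Embedding (K 1 r) G →
  ∀ {a b} → Fvs≡ G a → Ifvs≡ G b → b ≤ starBound r a
star-bound G r free ((T , T-fvs , refl) , _) ((I , (I-fvs , I-ind) , refl) , minimal) =
  StarFree.Minimal.I-bound G r free T T-fvs I I-fvs I-ind minimal


-- Families with bounded fvs and unbounded ifvs

-- The families have fvs at most `c`, not equal to it, and a bounding function may fail to be
-- monotone; its maximum up to `c` is what ifvs has to exceed.
maxUpTo : (ℕ → ℕ) → ℕ → ℕ
maxUpTo f zero    = f zero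
maxUpTo f (suc c) = maxUpTo f c ⊔ f (suc c)

≤-maxUpTo : ∀ f {a} c → a ≤ c → f a ≤ maxUpTo f c
≤-maxUpTo f zero    z≤n = ≤-refl
≤-maxUpTo f (suc c) a≤c with m≤n⇒m<n∨m≡n a≤c
... | inj₁ a<c  = ≤-trans (≤-maxUpTo f c (s≤s⁻¹ a<c)) (m≤m⊔n _ _)
... | inj₂ refl = m≤n⊔m _ _

-- Descent to ever smaller sets. Whether a smaller set exists is not decided, so the minimum is
-- obtained up to double negation, which suffices for refuting boundedness.
¬¬minSize : ∀ (Q : Subset n → Set) S → Q S → ¬ ¬ (∃[ k ] IsMinSize Q k × k ≤ ∣ S ∣)
¬¬minSize Q S QS none = descend S QS ≤-refl (<-wellFounded _)
  where
  descend : ∀ S′ → Q S′ → ∣ S′ ∣ ≤ ∣ S ∣ → Acc _<_ ∣ S′ ∣ → ⊥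
  descend S′ QS′ ≤S (acc rec) = none (∣ S′ ∣ , ((S′ , QS′ , refl) , minimal) , ≤S)
    where
    minimal : ∀ S″ → Q S″ → ∣ S′ ∣ ≤ ∣ S″ ∣
    minimal S″ QS″ = decidable-stable (_ ≤? _) λ ≰ →
      descend S″ QS″ (≤-trans (<⇒≤ (≰⇒> ≰)) ≤S) (rec (≰⇒> ≰))

record Gap {n} (G : Graph (Fin n)) (c N : ℕ) : Set where
  field
    ifvs    : NearBipartite G
    fvs     : ∃[ S ] IsFVS G S × ∣ S ∣ ≤ c
    large   : ∀ S → IsIFVS G S → N ≤ ∣ S ∣

gaps⇒unbounded : ∀ {H : Graph (Fin m)} c →
  (∀ N → ∃[ n ] Σ (Graph (Fin n)) λ G → Free G H × Gap G c N) → ¬ IfvsBounded (FreeNearBipartite H)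
gaps⇒unbounded c family (f , bound) with family (suc (maxUpTo f c))
... | n , G , free , gap =
  ¬¬minSize (IsFVS G) (proj₁ fvs) (proj₁ (proj₂ fvs)) λ (a , a-min , a≤) →
  ¬¬minSize (IsIFVS G) (proj₁ ifvs) (proj₂ ifvs) λ { (b , b-min@((S , S-ifvs , refl) , _) , _) →
  <-irrefl refl (≤-trans (large S S-ifvs)
    (≤-trans (bound n G (free , ifvs) a b a-min b-min) (≤-maxUpTo f c (≤-trans a≤ (proj₂ (proj₂ fvs)))))) }
  where open Gap gap

-- Lets the constructions use descriptive vertex types, with vertex sets given by predicates, before
-- moving to `Fin n`.
module Enumerated (φ : Fin n ↔ V) (G : Graph V) where

  open Inverse φ using (to; from; strictlyInverseˡ; strictlyInverseʳ)

  graph : Graph (Fin n)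
  graph = record
    { Adj    = Adj G on to
    ; symm   = symm G
    ; irrefl = λ u≡v → irrefl G (cong to u≡v)
    ; adj?   = λ u v → adj? G (to u) (to v)
    }

  to-injective : Injective _≡_ _≡_ to
  to-injective eq = trans (sym (strictlyInverseʳ _)) (trans (cong from eq) (strictlyInverseʳ _))

  from-injective : ∀ u v → from u ≡ from v → u ≡ v
  from-injective _ _ eq = trans (sym (strictlyInverseˡ _)) (trans (cong to eq) (strictlyInverseˡ _))

  from-adj : ∀ {u v} → Adj G u v → Adj graph (from u) (from v)
  from-adj = subst₂ (Adj G) (sym (strictlyInverseˡ _)) (sym (strictlyInverseˡ _))

  embedding : Embedding graph G
  embedding = record { to = to ; injective = to-injective ; adj = λ _ _ → mk⇔ id id }

  module _ {Q : V → Set} (Q? : Decidable Q) where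

    subset : Subset n
    subset = ⟦ (λ i → Q? (to i)) ⟧

    ∈-subset : ∀ {v} → Q v → from v ∈ subset
    ∈-subset Qv = ∈⟦⟧⁺ (λ i → Q? (to i)) (subst Q (sym (strictlyInverseˡ _)) Qv)

    subset-∈ : ∀ {i} → i ∈ subset → Q (to i)
    subset-∈ = ∈⟦⟧⁻ (λ i → Q? (to i))

    subset-≤ : (f : ∀ {v} → Q v → Fin s) → (∀ {u v} (p : Q u) (q : Q v) → f p ≡ f q → u ≡ v) → ∣ subset ∣ ≤ s
    subset-≤ f f-injective = ∣∣-≤ subset (λ i∈ → f (subset-∈ i∈)) λ _ _ eq → to-injective (f-injective _ _ eq)

    subset-independent : (∀ {u v} → Q u → Q v → ¬ Adj G u v) → IsIndependent graph subset
    subset-independent ind u v u∈ v∈ = ind (subset-∈ u∈) (subset-∈ v∈)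

    subset-fvs : (rank : V → ℕ) →
      (∀ {x p q} → ¬ Q x → ¬ Q p → ¬ Q q → Adj G x p → Adj G x q → rank x ≤ rank p → rank x ≤ rank q → p ≡ q) →
      IsFVS graph subset
    subset-fvs rank unique = ranked⇒fvs graph subset (rank ∘ to)
      λ x∉ p∉ q∉ xp xq x≤p x≤q → to-injective (unique (¬Q x∉) (¬Q p∉) (¬Q q∉) xp xq x≤p x≤q)
      where
      ¬Q : ∀ {i} → i ∉ subset → ¬ Q (to i)
      ¬Q i∉ Qi = i∉ (∈⟦⟧⁺ (λ i → Q? (to i)) Qi)

-- Forbidden induced subgraphs

record Triangle (G : Graph V) : Set where
  field
    {x y z} : V
    xy : Adj G x y
    yz : Adj G y z
    xz : Adj G x z

record InducedC₄ (G : Graph V) : Set where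
  field
    {w x y z} : V
    wx : Adj G w x
    xy : Adj G x y
    yz : Adj G y z
    zw : Adj G z w
    w≁y : ¬ Adj G w y
    x≁z : ¬ Adj G x z
    w≢y : w ≢ y
    x≢z : x ≢ z

record InducedP₄ (G : Graph V) : Set where
  field
    {w x y z} : V
    wx : Adj G w x
    xy : Adj G x y
    yz : Adj G y z
    w≁y : ¬ Adj G w y
    x≁z : ¬ Adj G x z
    w≁z : ¬ Adj G w z

-- The vertices a, b, c, d induce 2P₁ + P₂, 2P₂ or P₁ + P₃.
record ExtendedP₁+P₂ (G : Graph V) : Set where
  field
    {a b c d} : V
    ab : Adj G a b
    c≁a : ¬ Adj G c a
    c≁b : ¬ Adj G c b
    d≁b : ¬ Adj G d b
    ¬dac : ¬ (Adj G d a × Adj G d c)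
    d≢b : d ≢ b
    d≢c : d ≢ c

module _ {H : Graph V} {G : Graph W} (e : Embedding H G) where

  open Embedding e

  private
    ⇒ : ∀ {u v} → Adj H u v → Adj G (to u) (to v)
    ⇒ = Equivalence.to (adj _ _)

    ⇐ : ∀ {u v} → Adj G (to u) (to v) → Adj H u v
    ⇐ = Equivalence.from (adj _ _)

  map-triangle : Triangle H → Triangle G
  map-triangle t = record { xy = ⇒ xy ; yz = ⇒ yz ; xz = ⇒ xz }
    where open Triangle t

  map-C₄ : InducedC₄ H → InducedC₄ G
  map-C₄ c = record { wx = ⇒ wx ; xy = ⇒ xy ; yz = ⇒ yz ; zw = ⇒ zw ; w≁y = w≁y ∘ ⇐ ; x≁z = x≁z ∘ ⇐
    ; w≢y = w≢y ∘ injective ; x≢z = x≢z ∘ injective }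
    where open InducedC₄ c

  map-P₄ : InducedP₄ H → InducedP₄ G
  map-P₄ p = record { wx = ⇒ wx ; xy = ⇒ xy ; yz = ⇒ yz ; w≁y = w≁y ∘ ⇐ ; x≁z = x≁z ∘ ⇐ ; w≁z = w≁z ∘ ⇐ }
    where open InducedP₄ p

  map-extended : ExtendedP₁+P₂ H → ExtendedP₁+P₂ G
  map-extended q = record { ab = ⇒ ab ; c≁a = c≁a ∘ ⇐ ; c≁b = c≁b ∘ ⇐ ; d≁b = d≁b ∘ ⇐
    ; ¬dac = λ (da , dc) → ¬dac (⇐ da , ⇐ dc) ; d≢b = d≢b ∘ injective ; d≢c = d≢c ∘ injective }
    where open ExtendedP₁+P₂ q

≅-from-embedding : ∀ {X : Graph W} {H : Graph V} (e : Embedding X H) (g : V → W) →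
  (∀ v → Embedding.to e (g v) ≡ v) → H ≅ X
≅-from-embedding {X = X} {H} e g to-g =
  mk↔ₛ′ g to (λ w → injective (to-g (to w))) to-g ,
  λ u v → mk⇔
    (λ uv → Equivalence.from (adj (g u) (g v)) (subst₂ (Adj H) (sym (to-g u)) (sym (to-g v)) uv))
    (λ uv → subst₂ (Adj H) (to-g u) (to-g v) (Equivalence.to (adj (g u) (g v)) uv))
  where open Embedding e

star-from-centre : ∀ (H : Graph (Fin n)) → ¬ Triangle H → ∀ c → (∀ v → v ≢ c → Adj H c v) → IsStar H
star-from-centre {suc r} H ¬triangle c nbr =
  r , ≅-from-embedding e (λ v → proj₁ (preimage v)) (λ v → proj₂ (preimage v))
  where
  c~ : ∀ i → Adj H c (punchIn c i)
  c~ i = nbr _ (punchInᵢ≢i c i)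

  e : Embedding (K 1 r) H
  e = star-embedding H c (punchIn c) (λ eq → punchIn-injective c _ _ eq) c~
    λ i j ij → ¬triangle record { xy = c~ i ; yz = ij ; xz = c~ j }

  preimage : ∀ v → ∃[ w ] Embedding.to e w ≡ v
  preimage v with c ≟ v
  ... | yes c≡v = inj₁ zero , c≡v
  ... | no c≢v  = inj₂ (punchOut c≢v) , punchIn-punchOut c≢v

-- Graphs without the forbidden subgraphs

module Classification {n} (H : Graph (Fin n)) (¬triangle : ¬ Triangle H) (¬C₄ : ¬ InducedC₄ H)
  (¬P₄ : ¬ InducedP₄ H) (¬extended : ¬ ExtendedP₁+P₂ H) where

  -- If `d` is adjacent to both `a` and `c`, then `c d a b` is an induced `P₄`; otherwise the four
  -- vertices form an `ExtendedP₁+P₂`.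
  no-fourth-vertex : ∀ {a b c d} → Adj H a b → ¬ Adj H c a → ¬ Adj H c b → ¬ Adj H d b → d ≢ b → d ≢ c → ⊥
  no-fourth-vertex {a} {b} {c} {d} ab c≁a c≁b d≁b d≢b d≢c with adj? H d a ×-dec adj? H d c
  ... | yes (da , dc) = ¬P₄ record
    { wx = symm H dc ; xy = da ; yz = ab ; w≁y = c≁a ; x≁z = d≁b ; w≁z = c≁b }
  ... | no ¬dac = ¬extended record
    { ab = ab ; c≁a = c≁a ; c≁b = c≁b ; d≁b = d≁b ; ¬dac = ¬dac ; d≢b = d≢b ; d≢c = d≢c }

  -- A further vertex would miss `a` or `b`, as there are no triangles, and `no-fourth-vertex`
  -- excludes both cases by the symmetry of `a` and `b`.
  p₁+p₂ : ∀ {a b c} → Adj H a b → ¬ Adj H c a → ¬ Adj H c b → H ≅ P 1 ⊕ P 2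
  p₁+p₂ {a} {b} {c} ab c≁a c≁b = ≅-from-embedding e (λ v → proj₁ (preimage v)) (λ v → proj₂ (preimage v))
    where
    e : Embedding (P 1 ⊕ P 2) H
    e = P₁+P₂-embedding H ab c≁a c≁b

    preimage : ∀ v → ∃[ w ] Embedding.to e w ≡ v
    preimage v with v ≟ a | v ≟ b | v ≟ c | adj? H v b | adj? H v a
    ... | yes v≡a | _ | _ | _ | _ = inj₂ zero , sym v≡a
    ... | _ | yes v≡b | _ | _ | _ = inj₂ (suc zero) , sym v≡b
    ... | _ | _ | yes v≡c | _ | _ = inj₁ zero , sym v≡c
    ... | no v≢a | no v≢b | no v≢c | no v≁b | _ = ⊥-elim (no-fourth-vertex ab c≁a c≁b v≁b v≢b v≢c)
    ... | no v≢a | no v≢b | no v≢c | _ | no v≁a = ⊥-elim (no-fourth-vertex (symm H ab) c≁b c≁a v≁a v≢a v≢c)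
    ... | no v≢a | no v≢b | no v≢c | yes vb | yes va = ⊥-elim (¬triangle record { xy = va ; yz = ab ; xz = vb })

  -- If every vertex has a neighbour on the edge `a b`, the centre is `a` when `b` has no other
  -- neighbour. Otherwise it is `b`: with another neighbour `y` of `b`, a vertex `v` adjacent to `a`
  -- but not to `b` would make `v a b y` an induced `C₄` or `P₄`.
  classify : (H ≅ P 1 ⊕ P 2) ⊎ IsStar H ⊎ IsEdgeless H
  classify with any? (λ a → any? λ b → adj? H a b)
  ... | no edgeless′ = inj₂ (inj₂ (n , ↔-id _ , λ u v → mk⇔ (λ uv → edgeless′ (u , v , uv)) λ ()))
  ... | yes (a , b , ab) with any? (λ c → ¬? (adj? H c a) ×-dec ¬? (adj? H c b))
  ... | yes (c , c≁a , c≁b) = inj₁ (p₁+p₂ ab c≁a c≁b)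
  ... | no dominating with any? (λ y → ¬? (y ≟ a) ×-dec adj? H y b)
  ... | no none = inj₂ (inj₁ (star-from-centre H ¬triangle a λ v v≢a →
        decidable-stable (adj? H a v) λ a≁v → dominating (v , (λ va → a≁v (symm H va)) , λ vb → none (v , v≢a , vb))))
  ... | yes (y , y≢a , yb) = inj₂ (inj₁ (star-from-centre H ¬triangle b λ v v≢b →
        decidable-stable (adj? H b v) λ b≁v → dominating (v , v≁a v≢b b≁v , λ vb → b≁v (symm H vb))))
    where
    y≁a : ¬ Adj H y a
    y≁a ya = ¬triangle record { xy = ya ; yz = ab ; xz = yb }

    v≁a : ∀ {v} → v ≢ b → ¬ Adj H b v → ¬ Adj H v a
    v≁a {v} v≢b b≁v va with adj? H y v
    ... | yes yv = ¬C₄ record { wx = va ; xy = ab ; yz = symm H yb ; zw = yv ; w≁y = λ vb → b≁v (symm H vb)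
                              ; x≁z = λ ay → y≁a (symm H ay) ; w≢y = v≢b ; x≢z = λ eq → y≢a (sym eq) }
    ... | no y≁v = ¬P₄ record { wx = va ; xy = ab ; yz = symm H yb ; w≁y = λ vb → b≁v (symm H vb)
                              ; x≁z = λ ay → y≁a (symm H ay) ; w≁z = λ vy → y≁v (symm H vy) }

-- Two unbounded constructions

-- `L⊆P₄` makes `L` a forest, and its two disjoint edges force every independent set to miss two
-- vertices of `L`. Both `2P₂` and `P₄` qualify.
module Join (L : Graph (Fin 4)) (L⊆P₄ : ∀ {i j} → Adj L i j → Adj (P 4) i j)
  (e₀₁ : Adj L zero (suc zero)) (e₂₃ : Adj L (suc (suc zero)) (suc (suc (suc zero)))) where

  join : ∀ r → Graph (Fin 4 ⊎ Fin r)
  join r = record { Adj = A ; symm = λ {u} {v} → A-sym u v ; irrefl = λ { {u} refl → A-irrefl u } ; adj? = A? }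
    where
    A : Fin 4 ⊎ Fin r → Fin 4 ⊎ Fin r → Set
    A (inj₁ i) (inj₁ j) = Adj L i j
    A (inj₁ _) (inj₂ _) = ⊤
    A (inj₂ _) (inj₁ _) = ⊤
    A (inj₂ _) (inj₂ _) = ⊥

    A-sym : ∀ u v → A u v → A v u
    A-sym (inj₁ i) (inj₁ j) ij = symm L ij
    A-sym (inj₁ _) (inj₂ _) _  = tt
    A-sym (inj₂ _) (inj₁ _) _  = tt

    A-irrefl : ∀ u → ¬ A u u
    A-irrefl (inj₁ i) = irrefl L refl
    A-irrefl (inj₂ _) ()

    A? : ∀ u v → Dec (A u v)
    A? (inj₁ i) (inj₁ j) = adj? L i j
    A? (inj₁ _) (inj₂ _) = yes tt
    A? (inj₂ _) (inj₁ _) = yes tt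
    A? (inj₂ _) (inj₂ _) = no λ ()

  -- The complement of `P₄` is connected, so an induced `P₄` lies on one side of the join, and the
  -- right side has no edges.
  P₄-in-L : ∀ {r} → InducedP₄ (join r) → InducedP₄ L
  P₄-in-L {r} p = go {w} {x} {y} {z} wx xy yz w≁y x≁z w≁z
    where
    open InducedP₄ p
    go : ∀ {w x y z} (let A = Adj (join r)) → A w x → A x y → A y z → ¬ A w y → ¬ A x z → ¬ A w z → InducedP₄ L
    go {w = inj₁ _} {inj₁ _} {inj₁ _} {inj₁ _} wx xy yz w≁y x≁z w≁z =
      record { wx = wx ; xy = xy ; yz = yz ; w≁y = w≁y ; x≁z = x≁z ; w≁z = w≁z }
    go {w = inj₁ _} {inj₂ _} {inj₁ _} {inj₁ _} wx xy yz w≁y x≁z w≁z = contradiction tt x≁z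
    go {w = inj₁ _} {x} {inj₁ _} {inj₂ _} wx xy yz w≁y x≁z w≁z = contradiction tt w≁z
    go {w = inj₁ _} {x} {inj₂ _} wx xy yz w≁y x≁z w≁z = contradiction tt w≁y
    go {w = inj₂ _} {x} {inj₁ _} wx xy yz w≁y x≁z w≁z = contradiction tt w≁y
    go {w = inj₂ _} {x} {inj₂ _} {inj₁ _} wx xy yz w≁y x≁z w≁z = contradiction tt w≁z

  -- The non-edges `c a`, `c b` and `d b` keep all four vertices on one side of the join, and the
  -- edge `a b` excludes the right side.
  extended-in-L : ∀ {r} → ExtendedP₁+P₂ (join r) → ExtendedP₁+P₂ L
  extended-in-L {r} q = go {a} {b} {c} {d} ab c≁a c≁b d≁b ¬dac d≢b d≢c
    where
    open ExtendedP₁+P₂ q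
    go : ∀ {a b c d} (let A = Adj (join r)) → A a b → ¬ A c a → ¬ A c b → ¬ A d b →
      ¬ (A d a × A d c) → d ≢ b → d ≢ c → ExtendedP₁+P₂ L
    go {a = inj₁ _} {inj₁ _} {inj₁ _} {inj₁ _} ab c≁a c≁b d≁b ¬dac d≢b d≢c = record
      { ab = ab ; c≁a = c≁a ; c≁b = c≁b ; d≁b = d≁b ; ¬dac = ¬dac
      ; d≢b = λ eq → d≢b (cong inj₁ eq) ; d≢c = λ eq → d≢c (cong inj₁ eq) }
    go {a = inj₁ _} {inj₁ _} {inj₁ _} {inj₂ _} ab c≁a c≁b d≁b ¬dac d≢b d≢c = contradiction tt d≁b
    go {a = inj₁ _} {inj₂ _} {inj₁ _} ab c≁a c≁b d≁b ¬dac d≢b d≢c = contradiction tt c≁b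
    go {a = inj₁ _} {b} {inj₂ _} ab c≁a c≁b d≁b ¬dac d≢b d≢c = contradiction tt c≁a
    go {a = inj₂ _} {b} {inj₁ _} ab c≁a c≁b d≁b ¬dac d≢b d≢c = contradiction tt c≁a
    go {a = inj₂ _} {inj₁ _} {inj₂ _} ab c≁a c≁b d≁b ¬dac d≢b d≢c = contradiction tt c≁b

  module _ (N : ℕ) where

    -- The extra vertex ensures that a set with fewer than `N` elements misses two right vertices.
    r = suc N

    module E = Enumerated (+↔⊎ {4} {r}) (join r)
    open Inverse (+↔⊎ {4} {r}) using (to; from; strictlyInverseˡ)

    Left Right : Fin 4 ⊎ Fin r → Set
    Left v  = ∃[ i ] v ≡ inj₁ i
    Right v = ∃[ i ] v ≡ inj₂ i

    left? : Decidable Left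
    left? (inj₁ i) = yes (i , refl)
    left? (inj₂ _) = no λ ()

    right? : Decidable Right
    right? (inj₁ _) = no λ ()
    right? (inj₂ i) = yes (i , refl)

    right-fvs : IsFVS E.graph (E.subset right?)
    right-fvs = E.subset-fvs right? rank unique
      where
      rank : Fin 4 ⊎ Fin r → ℕ
      rank (inj₁ i) = toℕ i
      rank (inj₂ _) = 0

      up : ∀ {i j} → Adj L i j → toℕ i ≤ toℕ j → toℕ j ≡ suc (toℕ i)
      up ij i≤j with L⊆P₄ ij
      ... | inj₁ eq = eq
      ... | inj₂ eq = contradiction (≤-trans (≤-reflexive (sym eq)) i≤j) (<-irrefl refl)

      unique : ∀ {x p q} → ¬ Right x → ¬ Right p → ¬ Right q → Adj (join r) x p → Adj (join r) x q →
        rank x ≤ rank p → rank x ≤ rank q → p ≡ q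
      unique {inj₁ _} {inj₁ _} {inj₁ _} _ _ _ xp xq x≤p x≤q =
        cong inj₁ (toℕ-injective (trans (up xp x≤p) (sym (up xq x≤q))))
      unique {inj₂ i} ¬x _ _ _ _ _ _ = contradiction (i , refl) ¬x
      unique {inj₁ _} {inj₂ i} _ ¬p _ _ _ _ _ = contradiction (i , refl) ¬p
      unique {inj₁ _} {inj₁ _} {inj₂ i} _ _ ¬q _ _ _ _ = contradiction (i , refl) ¬q

    left-fvs : IsFVS E.graph (E.subset left?)
    left-fvs = E.subset-fvs left? (λ _ → 0) unique
      where
      unique : ∀ {x p q} → ¬ Left x → ¬ Left p → ¬ Left q → Adj (join r) x p → Adj (join r) x q →
        0 ≤ 0 → 0 ≤ 0 → p ≡ q
      unique {inj₁ i} ¬x _ _ _ _ _ _ = contradiction (i , refl) ¬x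
      unique {inj₂ _} {inj₁ i} _ ¬p _ _ _ _ _ = contradiction (i , refl) ¬p

    right-size : r ≤ ∣ E.subset right? ∣
    right-size = ∣∣-≥ (E.subset right?) (λ i → from (inj₂ i))
      (λ {i} {j} eq → inj₂-injective (E.from-injective (inj₂ i) (inj₂ j) eq)) (λ i → E.∈-subset right? (i , refl))

    -- An independent set misses an end of each of the two edges of L, and two right
    -- vertices outside it would form a 4-cycle with these ends.
    large : ∀ S → IsIFVS E.graph S → N ≤ ∣ S ∣
    large S (S-fvs , S-ind) = decidable-stable (_ ≤? _) λ ≰ →
      let g , g-inj , g∈ , g∉ = choose (E.subset right?) S (≤-trans (s≤s (≰⇒> ≰)) right-size)
          p , p∉ , p₀₁ = missed e₀₁
          q , q∉ , q₂₃ = missed e₂₃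
      in noSquare E.graph S-fvs p∉ (g∉ zero) q∉ (g∉ (suc zero))
           (λ eq → apart p₀₁ q₂₃ (E.from-injective (inj₁ p) (inj₁ q) eq)) (λ eq → case g-inj eq of λ ())
           (cross p (g∈ zero)) (cross′ q (g∈ zero))
           (cross q (g∈ (suc zero))) (cross′ p (g∈ (suc zero)))
      where
      missed : ∀ {i j} → Adj L i j → ∃[ p ] from (inj₁ p) ∉ S × (p ≡ i ⊎ p ≡ j)
      missed {i} {j} ij with from (inj₁ i) ∈? S
      ... | no i∉  = i , i∉ , inj₁ refl
      ... | yes i∈ = j , (λ j∈ → S-ind _ _ i∈ j∈ (E.from-adj {inj₁ i} {inj₁ j} ij)) , inj₂ refl

      apart : ∀ {p q : Fin 4} → p ≡ zero ⊎ p ≡ suc zero → q ≡ suc (suc zero) ⊎ q ≡ suc (suc (suc zero)) →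
        inj₁ {B = Fin r} p ≢ inj₁ q
      apart (inj₁ refl) (inj₁ refl) ()
      apart (inj₁ refl) (inj₂ refl) ()
      apart (inj₂ refl) (inj₁ refl) ()
      apart (inj₂ refl) (inj₂ refl) ()

      cross : ∀ p {v} → v ∈ E.subset right? → Adj E.graph (from (inj₁ p)) v
      cross p v∈ with E.subset-∈ right? v∈
      ... | i , eq = subst₂ (Adj (join r)) (sym (strictlyInverseˡ (inj₁ p))) (sym eq) tt

      cross′ : ∀ p {v} → v ∈ E.subset right? → Adj E.graph v (from (inj₁ p))
      cross′ p {v} v∈ = symm E.graph {from (inj₁ p)} {v} (cross p v∈)

    gap : Gap E.graph 4 N
    gap = record
      { ifvs  = E.subset right? , right-fvs , E.subset-independent right? λ { {_} {_} (_ , refl) (_ , refl) () }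
      ; fvs   = E.subset left? , left-fvs ,
          E.subset-≤ left? proj₁ λ { (_ , refl) (_ , refl) refl → refl }
      ; large = large
      }

2P₂ : Graph (Fin 4)
2P₂ = record
  { Adj    = λ i j → half i ≡ half j × i ≢ j
  ; symm   = λ (eq , i≢j) → sym eq , λ j≡i → i≢j (sym j≡i)
  ; irrefl = λ i≡j (_ , i≢j) → i≢j i≡j
  ; adj?   = λ i j → (half i ≟ half j) ×-dec ¬? (i ≟ j)
  }
  where
  half : Fin 4 → Fin 2
  half zero          = zero
  half (suc zero)    = zero
  half (suc (suc _)) = suc zero

module Join₂ₚ₂ = Join 2P₂
  (from-yes (all? λ i → all? λ j → adj? 2P₂ i j →-dec adj? (P 4) i j) _ _) (refl , λ ()) (refl , λ ())

module Joinₚ₄ = Join (P 4) id (inj₁ refl) (inj₁ refl)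

-- Adjacent vertices are distinct vertices of the same half, so `w` and `y`, which share the
-- neighbour `x` but are not adjacent, coincide; then `y z` contradicts `w≁z`.
2P₂-¬P₄ : ¬ InducedP₄ 2P₂
2P₂-¬P₄ p = w≁z (subst (λ v → Adj 2P₂ v z) (sym w≡y) yz)
  where
  open InducedP₄ p
  w≡y : w ≡ y
  w≡y = decidable-stable (w ≟ y) λ w≢y → w≁y (trans (proj₁ wx) (proj₁ xy) , w≢y)

P₄-¬extended : ¬ ExtendedP₁+P₂ (P 4)
P₄-¬extended q = none a b c d ab c≁a c≁b d≁b ¬dac d≢b d≢c
  where
  open ExtendedP₁+P₂ q
  A? = adj? (P 4)
  none : ∀ a b c d (let A = Adj (P 4)) → A a b → ¬ A c a → ¬ A c b → ¬ A d b → ¬ (A d a × A d c) → d ≢ b → ¬ d ≢ c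
  none = from-yes (all? λ a → all? λ b → all? λ c → all? λ d →
    A? a b →-dec ¬? (A? c a) →-dec ¬? (A? c b) →-dec ¬? (A? d b) →-dec
    ¬? (A? d a ×-dec A? d c) →-dec ¬? (d ≟ b) →-dec ¬? (¬? (d ≟ c)))

-- Two adjacent hubs, each on `r` cycles of length `3 + k`

module Hubs (k r : ℕ) where

  -- inj₁ b is a hub, and inj₂ (b , i , c) is the c-th vertex of the i-th path, whose ends
  -- are adjacent to the hub b.
  HubV : Set
  HubV = Fin 2 ⊎ (Fin 2 × Fin r × Fin (2 + k))

  φ : Fin (2 + 2 * (r * (2 + k))) ↔ HubV
  φ = (↔-id _ ⊎-↔ ((↔-id _ ×-↔ *↔×) ↔-∘ *↔×)) ↔-∘ +↔⊎

  open Inverse φ using (to; from; strictlyInverseˡ)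

  last : Fin (2 + k)
  last = fromℕ (suc k)

  End : Fin (2 + k) → Set
  End c = c ≡ zero ⊎ c ≡ last

  end? : Decidable End
  end? c = (c ≟ zero) ⊎-dec (c ≟ last)

  hubs : Graph HubV
  hubs = record { Adj = A ; symm = λ {u} {v} → A-sym u v ; irrefl = λ { {u} refl → A-irrefl u } ; adj? = A? }
    where
    A : HubV → HubV → Set
    A (inj₁ b)           (inj₁ b′)             = b ≢ b′
    A (inj₁ b)           (inj₂ (b′ , _ , c))   = b ≡ b′ × End c
    A (inj₂ (b , _ , c)) (inj₁ b′)             = b′ ≡ b × End c
    A (inj₂ (b , i , c)) (inj₂ (b′ , i′ , c′)) = b ≡ b′ × i ≡ i′ × Adj (P (2 + k)) c c′

    A-sym : ∀ u v → A u v → A v u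
    A-sym (inj₁ _) (inj₁ _) b≢b′          = λ eq → b≢b′ (sym eq)
    A-sym (inj₁ _) (inj₂ _) a             = a
    A-sym (inj₂ _) (inj₁ _) a             = a
    A-sym (inj₂ _) (inj₂ _) (b≡ , i≡ , cc) = sym b≡ , sym i≡ , symm (P (2 + k)) cc

    A-irrefl : ∀ u → ¬ A u u
    A-irrefl (inj₁ _) b≢b          = b≢b refl
    A-irrefl (inj₂ _) (_ , _ , cc) = irrefl (P (2 + k)) refl cc

    A? : ∀ u v → Dec (A u v)
    A? (inj₁ b)           (inj₁ b′)             = ¬? (b ≟ b′)
    A? (inj₁ b)           (inj₂ (b′ , _ , c))   = (b ≟ b′) ×-dec end? c
    A? (inj₂ (b , _ , c)) (inj₁ b′)             = (b′ ≟ b) ×-dec end? c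
    A? (inj₂ (b , i , c)) (inj₂ (b′ , i′ , c′)) = (b ≟ b′) ×-dec (i ≟ i′) ×-dec adj? (P (2 + k)) c c′

  module E = Enumerated φ hubs

  -- Positions on a path are at most `1 + k`, so the hubs are ranked above all path vertices. The
  -- same ranking serves for both feedback vertex sets.
  rank : HubV → ℕ
  rank (inj₁ _)           = 2 + k
  rank (inj₂ (_ , _ , c)) = toℕ c

  up : ∀ {c c′ : Fin (2 + k)} → Adj (P (2 + k)) c c′ → toℕ c ≤ toℕ c′ → toℕ c′ ≡ suc (toℕ c)
  up (inj₁ eq) _ = eq
  up (inj₂ eq) c≤c′ = contradiction (≤-trans (≤-reflexive (sym eq)) c≤c′) (<-irrefl refl)

  -- `Cut` witnesses near-bipartiteness: hub `zero` meets all cycles on its side, and on the other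
  -- side each path loses its first vertex, which is not adjacent to hub `zero`.
  Hub Cut : HubV → Set
  Hub v = ∃[ b ] v ≡ inj₁ b
  Cut (inj₁ b)           = b ≡ zero
  Cut (inj₂ (b , _ , c)) = b ≡ suc zero × c ≡ zero

  hub? : Decidable Hub
  hub? (inj₁ b) = yes (b , refl)
  hub? (inj₂ _) = no λ ()

  cut? : Decidable Cut
  cut? (inj₁ b)           = b ≟ zero
  cut? (inj₂ (b , _ , c)) = (b ≟ suc zero) ×-dec (c ≟ zero)

  hub-fvs : IsFVS E.graph (E.subset hub?)
  hub-fvs = E.subset-fvs hub? rank unique
    where
    unique : ∀ {x p q} → ¬ Hub x → ¬ Hub p → ¬ Hub q → Adj hubs x p → Adj hubs x q →
      rank x ≤ rank p → rank x ≤ rank q → p ≡ q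
    unique {inj₁ b} ¬x _ _ _ _ _ _ = contradiction (b , refl) ¬x
    unique {inj₂ _} {inj₁ b} _ ¬p _ _ _ _ _ = contradiction (b , refl) ¬p
    unique {inj₂ _} {inj₂ _} {inj₁ b} _ _ ¬q _ _ _ _ = contradiction (b , refl) ¬q
    unique {inj₂ _} {inj₂ _} {inj₂ _} _ _ _ (refl , refl , xp) (refl , refl , xq) x≤p x≤q =
      cong (λ c → inj₂ (_ , _ , c)) (toℕ-injective (trans (up xp x≤p) (sym (up xq x≤q))))

  -- After the deletion, a path vertex attached to the remaining hub is the last on its path, so
  -- this hub is its only neighbour of no smaller rank.
  cut-fvs : IsFVS E.graph (E.subset cut?)
  cut-fvs = E.subset-fvs cut? rank unique
    where
    above-last : ∀ {c c′ : Fin (2 + k)} → c ≡ last → toℕ c′ ≢ suc (toℕ c)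
    above-last {_} {c′} refl eq = <-irrefl (trans eq (cong suc (toℕ-fromℕ (suc k)))) (toℕ<n c′)

    remaining-hub : ∀ {b : Fin 2} → b ≢ zero → b ≡ suc zero
    remaining-hub {zero}     b≢0 = contradiction refl b≢0
    remaining-hub {suc zero} _   = refl

    attached-last : ∀ (b : Fin 2) i c → ¬ Cut (inj₁ b) → ¬ Cut (inj₂ (b , i , c)) → End c → c ≡ last
    attached-last _ _ _ ¬b ¬c (inj₁ refl) = contradiction (remaining-hub ¬b , refl) ¬c
    attached-last _ _ _ ¬b ¬c (inj₂ eq)   = eq

    unique : ∀ {x p q} → ¬ Cut x → ¬ Cut p → ¬ Cut q → Adj hubs x p → Adj hubs x q →
      rank x ≤ rank p → rank x ≤ rank q → p ≡ q
    unique {inj₁ _} {inj₁ _} ¬x ¬p _ xp _ _ _ =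
      contradiction (trans (remaining-hub ¬x) (sym (remaining-hub ¬p))) xp
    unique {inj₁ _} {inj₂ (_ , _ , c)} _ _ _ _ _ x≤p _ = contradiction (≤-trans (toℕ<n c) x≤p) (<-irrefl refl)
    unique {inj₂ _} {inj₁ _} {inj₁ _} _ _ _ (refl , _) (refl , _) _ _ = refl
    unique {inj₂ (b , i , c)} {inj₁ _} {inj₂ _} ¬x ¬p _ (refl , end) (_ , _ , xq) _ x≤q =
      contradiction (up xq x≤q) (above-last (attached-last b i c ¬p ¬x end))
    unique {inj₂ (b , i , c)} {inj₂ _} {inj₁ _} ¬x _ ¬q (_ , _ , xp) (refl , end) x≤p _ =
      contradiction (up xp x≤p) (above-last (attached-last b i c ¬q ¬x end))
    unique {inj₂ _} {inj₂ _} {inj₂ _} _ _ _ (refl , refl , xp) (refl , refl , xq) x≤p x≤q =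
      cong (λ c → inj₂ (_ , _ , c)) (toℕ-injective (trans (up xp x≤p) (sym (up xq x≤q))))

  cut-independent : ∀ {u v} → Cut u → Cut v → ¬ Adj hubs u v
  cut-independent {inj₁ _} {inj₁ _} refl refl b≢b = b≢b refl
  cut-independent {inj₁ _} {inj₂ _} refl (refl , _) (() , _)
  cut-independent {inj₂ _} {inj₁ _} (refl , _) refl (() , _)
  cut-independent {inj₂ _} {inj₂ _} (_ , refl) (_ , refl) (_ , _ , cc) = irrefl (P (2 + k)) refl cc

  -- Some hub is outside S, and each of the r cycles through it meets S.
  large : ∀ S → IsIFVS E.graph S → r ≤ ∣ S ∣
  large S (S-fvs , S-ind) with missing-hub
    where
    missing-hub : ∃[ b ] from (inj₁ b) ∉ S
    missing-hub with from (inj₁ zero) ∈? S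
    ... | no 0∉  = zero , 0∉
    ... | yes 0∈ = suc zero , λ 1∈ → S-ind _ _ 0∈ 1∈ (E.from-adj {inj₁ zero} {inj₁ (suc zero)} λ ())
  ... | b , b∉S = ∣∣-≥ S (λ i → onPath i (proj₁ (hit i)))
      (λ {i} {j} eq → cong (proj₁ ∘ proj₂)
        (inj₂-injective (E.from-injective (inj₂ (b , i , _)) (inj₂ (b , j , _)) eq)))
      (λ i → proj₂ (hit i))
    where
    onPath : Fin r → Fin (2 + k) → Fin _
    onPath i c = from (inj₂ (b , i , c))

    hit : ∀ i → ∃[ c ] onPath i c ∈ S
    hit i with any? (λ c → onPath i c ∈? S)
    ... | yes found = found
    ... | no avoided = ⊥-elim (S-fvs (closeWalk E.graph S b∉S
        (λ eq → case E.from-injective (inj₂ (b , i , zero)) (inj₂ (b , i , last)) eq of λ ())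
        (E.from-adj {inj₁ b} {inj₂ (b , i , zero)} (refl , inj₁ refl))
        (E.from-adj {inj₁ b} {inj₂ (b , i , last)} (refl , inj₂ refl))
        (weaken (λ { (c , _ , refl) → (λ c∈ → avoided (c , c∈)) ,
                                λ eq → case E.from-injective (inj₂ (b , i , c)) (inj₁ b) eq of λ () })
          (prefixWalk (suc k) (onPath i)
            (λ c → E.from-adj {inj₂ (b , i , inject₁ c)} {inj₂ (b , i , suc c)}
              (refl , refl , inj₁ (cong suc (sym (toℕ-inject₁ c))))) last))))

  gap : Gap E.graph 2 r
  gap = record
    { ifvs  = E.subset cut? , cut-fvs , E.subset-independent cut? (λ {u} {v} → cut-independent {u} {v})
    ; fvs   = E.subset hub? , hub-fvs , E.subset-≤ hub? proj₁ λ { (_ , refl) (_ , refl) refl → refl }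
    ; large = large
    }

-- For k = 1 the graph is bipartite.
module _ (r : ℕ) where

  open Hubs 1 r

  hubs-¬triangle : ¬ Triangle hubs
  hubs-¬triangle t = noRainbow (colour x) (colour y) (colour z) (proper xy) (proper yz) (proper xz)
    where
    open Triangle t
    pathColour : Fin 2 → Fin 3 → Fin 2
    pathColour b (suc zero) = b
    pathColour b _          = opposite b

    colour : HubV → Fin 2
    colour (inj₁ b)           = b
    colour (inj₂ (b , _ , c)) = pathColour b c

    hub-path : ∀ b c → End c → b ≢ pathColour b c
    hub-path = from-yes (all? λ (b : Fin 2) → all? λ c → end? c →-dec ¬? (b ≟ pathColour b c))

    path-path : ∀ b c c′ → Adj (P 3) c c′ → pathColour b c ≢ pathColour b c′
    path-path = from-yes (all? λ (b : Fin 2) → all? λ c → all? λ c′ →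
      adj? (P 3) c c′ →-dec ¬? (pathColour b c ≟ pathColour b c′))

    proper : ∀ {u v} → Adj hubs u v → colour u ≢ colour v
    proper {inj₁ _} {inj₁ _} b≢b′ = b≢b′
    proper {inj₁ b} {inj₂ (_ , _ , c)} (refl , end) = hub-path b c end
    proper {inj₂ (_ , _ , c)} {inj₁ b} (refl , end) eq = hub-path b c end (sym eq)
    proper {inj₂ (b , _ , c)} {inj₂ (_ , _ , c′)} (refl , _ , cc) = path-path b c c′ cc

    noRainbow : ∀ (i j l : Fin 2) → i ≢ j → j ≢ l → ¬ i ≢ l
    noRainbow = from-yes (all? λ (i : Fin 2) → all? λ j → all? λ l →
      ¬? (i ≟ j) →-dec ¬? (j ≟ l) →-dec ¬? (¬? (i ≟ l)))

-- For k = 0 the neighbourhood of a vertex on a path is a clique, so that an induced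
-- 4-cycle would have to consist of hubs.
module _ (r : ℕ) where

  open Hubs 0 r

  hubs-¬C₄ : ¬ InducedC₄ hubs
  hubs-¬C₄ C = clash (isHub x (symm hubs {w} {x} wx) xy w≢y w≁y) (isHub y (symm hubs {x} {y} xy) yz x≢z x≁z)
                     (isHub w (symm hubs {z} {w} zw) wx (λ eq → x≢z (sym eq)) (λ zx → x≁z (symm hubs {z} {x} zx)))
    where
    open InducedC₄ C

    end : ∀ c → End c
    end zero       = inj₁ refl
    end (suc zero) = inj₂ refl

    P₂-unique : ∀ c c′ c″ → Adj (P 2) c c′ → Adj (P 2) c c″ → c′ ≡ c″
    P₂-unique = from-yes (all? λ c → all? λ c′ → all? λ c″ →
      adj? (P 2) c c′ →-dec adj? (P 2) c c″ →-dec (c′ ≟ c″))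

    isHub : ∀ v {p q} → Adj hubs v p → Adj hubs v q → p ≢ q → ¬ Adj hubs p q → Hub v
    isHub (inj₁ b) _ _ _ _ = b , refl
    isHub (inj₂ _) {inj₁ _} {inj₁ _} (refl , _) (refl , _) p≢q _ = contradiction refl p≢q
    isHub (inj₂ _) {inj₁ _} {inj₂ (_ , _ , c)} (refl , _) (refl , _) _ p≁q = contradiction (refl , end c) p≁q
    isHub (inj₂ _) {inj₂ (_ , _ , c)} {inj₁ _} (refl , _) (refl , _) _ p≁q = contradiction (refl , end c) p≁q
    isHub (inj₂ (_ , _ , c)) {inj₂ (_ , _ , c′)} {inj₂ (_ , _ , c″)} (refl , refl , cc′) (refl , refl , cc″) p≢q _ =
      contradiction (cong (λ c → inj₂ (_ , _ , c)) (P₂-unique c c′ c″ cc′ cc″)) p≢q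

    -- Distinct hubs are adjacent, whereas `w` and `y` are distinct and non-adjacent.
    clash : Hub x → Hub y → Hub w → ⊥
    clash _ (_ , refl) (_ , refl) = w≁y λ { refl → w≢y refl }

-- Necessity and the final equivalence

module _ (H : Graph (Fin n)) (bounded : IfvsBounded (FreeNearBipartite H)) where

  bounded⇒¬triangle : ¬ Triangle H
  bounded⇒¬triangle t = gaps⇒unbounded {H = H} 2 (λ N → let open Hubs 1 N in _ , E.graph ,
    (λ ind → hubs-¬triangle N (map-triangle E.embedding
      (map-triangle (induced⇒embedding {H = H} {G = E.graph} ind) t))) ,
    gap) bounded

  bounded⇒¬C₄ : ¬ InducedC₄ H
  bounded⇒¬C₄ t = gaps⇒unbounded {H = H} 2 (λ N → let open Hubs 0 N in _ , E.graph ,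
    (λ ind → hubs-¬C₄ N (map-C₄ E.embedding (map-C₄ (induced⇒embedding {H = H} {G = E.graph} ind) t))) ,
    gap) bounded

  bounded⇒¬P₄ : ¬ InducedP₄ H
  bounded⇒¬P₄ t = gaps⇒unbounded {H = H} 4 (λ N → let open Join₂ₚ₂ in _ , E.graph N ,
    (λ ind → 2P₂-¬P₄ (P₄-in-L (map-P₄ (E.embedding N)
      (map-P₄ (induced⇒embedding {H = H} {G = E.graph N} ind) t)))) ,
    gap N) bounded

  bounded⇒¬extended : ¬ ExtendedP₁+P₂ H
  bounded⇒¬extended t = gaps⇒unbounded {H = H} 4 (λ N → let open Joinₚ₄ in _ , E.graph N ,
    (λ ind → P₄-¬extended (extended-in-L (map-extended (E.embedding N)
      (map-extended (induced⇒embedding {H = H} {G = E.graph N} ind) t)))) ,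
    gap N) bounded

theorem3 : ∀ (n : ℕ) (H : Graph (Fin n)) →
    IfvsBounded (FreeNearBipartite H) ⇔ ((H ≅ P 1 ⊕ P 2) ⊎ IsStar H ⊎ IsEdgeless H)
theorem3 n H = mk⇔
  (λ bounded → Classification.classify H (bounded⇒¬triangle H bounded) (bounded⇒¬C₄ H bounded)
    (bounded⇒¬P₄ H bounded) (bounded⇒¬extended H bounded))
  λ where
    (inj₁ H≅P₁+P₂) → suc , λ _ G (free , _) _ _ →
      CompleteMultipartite.bound G (free⇒¬embedding {H = H} {X = P 1 ⊕ P 2} {G = G} H≅P₁+P₂ free)
    (inj₂ (inj₁ (r , H≅K))) → starBound r , λ _ G (free , _) _ _ →
      star-bound G r (free⇒¬embedding {H = H} {X = K 1 r} {G = G} H≅K free)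
    (inj₂ (inj₂ (r , H≅edgeless))) → (λ _ → r) , λ _ G (free , _) _ _ _ →
      edgeless-bound G r (free⇒¬embedding {H = H} {X = edgeless r} {G = G} H≅edgeless free)
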